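{- Let $k\ge1$ be an integer, let $G$ be a finite graph, and let $S$ be a (symmetric) set of proper separations of $G$ of order $<k$ that includes all the tight proper separations of $G$ of order $<k$. Then $G$ has an $S$-canonical tree-decomposition all whose separations induced by tree-edges are in $S$ such that (i) distinct $k$-blocks lie in different parts; (ii) parts containing a $k$-block that is well separated in $S$ coincide with that $k$-block; (iii) if the task $(S,\mathcal P)$, with $\mathcal P$ the set of all $k$-block profiles, is reduced and feasible, then every leaf part is a $k$-block. Moreover, every $S$-canonical tree-decomposition of $G$ all whose separations induced by tree-edges are in $S$ and which satisfies (i), but not necessarily (ii) or (iii), can be refined to an $S$-canonical tree-decomposition of $G$ all whose separations induced by tree-edges are in $S$ that satisfies (i) and also (ii) and (iii).
   Context: A separation of $G=(V,E)$ is an ordered pair $(A,B)$ with $A\cup B=V$ such that no edge joins $A\setminus B$ to $B\setminus A$; its order is $|A\cap B|$. It is proper if neither $A\subseteq B$ nor $B\subseteq A$, and tight if every vertex in $A\cap B$ has a neighbour in $A\setminus B$ and a neighbour in $B\setminus A$. Write $(A,B)\le(C,D)$ if $A\subseteq C$ and $B\supseteq D$. Two separations are nested if one is $\le$-comparable with the other or with the other's inverse (the inverse of $(C,D)$ is $(D,C)$); otherwise they cross. A set of separations is symmetric (a separation system) if it is closed under taking inverses. A $k$-block of $G$ is a maximal set $X$ of at least $k$ vertices such that no two vertices $x,x'\in X$ can be separated in $G$ by fewer than $k$ vertices other than $x$ and $x'$. The $k$-profile induced by a $k$-block $X$ (a $k$-block profile) is the set $P_k(X)$ of all separations $(A,B)$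 of $G$ of order $<k$ with $X\subseteq B$. The $k$-block $X$ is well separated in $S$ if the $\le$-maximal elements of $P_k(X)\cap S$ are pairwise nested. Let $\mathcal P$ be the set of all $k$-block profiles of $G$. The task $(S,\mathcal P)$ is reduced if for every $(A,B)\in S$ there are $P,P'\in\mathcal P$ with $(A,B)\in P$ and $(B,A)\in P'$. It is feasible if, whenever $(A,B),(C,D)\in S$ cross and there are $P,P'\in\mathcal P$ with $(A,B),(C,D)\in P$ and $(B,A),(D,C)\in P'$, there exists $(E,F)\in P\cap S$ with $(A\cup C,B\cap D)\le(E,F)$. For a tree-decomposition $(T,(V_t)_{t\in T})$ of $G$, each edge $e=t_1t_2$ of $T$ induces the separation $\big(\bigcup_{t\in T_1}V_t,\bigcup_{t\in T_2}V_t\big)$ and its inverse, where $T_i$ is the component of $T-e$ containing $t_i$. The sets $V_t$ are the parts; a leaf part is a part $V_t$ with $t$ a leaf of $T$. The tree-decomposition is $S$-canonical if it is invariant under all automorphisms of $G$ that act on $S$, i.e. for every automorphism $\alpha$ of $G$ mapping $S$ to itself there is an automorphism $\varphi$ of $T$ with $\alpha(V_t)=V_{\varphi(t)}$ for all $t\in T$. A tree-decomposition refines another if the set of separations induced by the edges of its tree contains the set of separations induced by the edges of the tree of the other. -}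

module Defs where

open import Data.Fin.Base using (Fin)
open import Data.Fin.Permutation using (Permutation′; _⟨$⟩ʳ_; _⟨$⟩ˡ_)
open import Data.Fin.Subset using (Subset; _∈_; _∉_; _⊆_; _∩_; _∪_; _─_; ⊤; ∣_∣)
open import Data.List.Base using (List; _∷_; []; _++_; head; last; length)
open import Data.List.Membership.Propositional using () renaming (_∈_ to _∈ˡ_)
open import Data.List.Relation.Unary.Any using (Any)
open import Data.List.Relation.Unary.Linked using (Linked)
open import Data.List.Relation.Unary.Unique.Propositional using (Unique)
open import Data.Maybe.Base using (just)
open import Data.Nat.Base using (ℕ; _≤_; _<_; _≥_)
open import Data.Product using (∃!)
open import Data.Product.Base using (_×_; _,_; ∃-syntax; ∃₂; proj₂; swap)
open import Data.Sum.Base using (_⊎_)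
open import Data.Vec.Base using (tabulate; lookup)
open import Function.Bundles using (_⇔_)
open import Level using (0ℓ)
open import Relation.Binary.Core using (Rel)
open import Relation.Binary.Definitions using (Decidable; Symmetric; Irreflexive)
open import Relation.Binary.PropositionalEquality.Core using (_≡_; _≢_)
open import Relation.Nullary.Negation.Core using (¬_)
open import Relation.Unary using (Pred; _≐_) renaming (_∩_ to _∩ᵖ_)

record Graph (n : ℕ) : Set₁ where
  field
    Adj    : Rel (Fin n) 0ℓ
    adj?   : Decidable Adj
    sym    : Symmetric Adj
    irrefl : Irreflexive _≡_ Adj

open Graph public using (Adj)

-- xs lists the vertices of a path from x to y in the graph with edge relation R.
IsPath : ∀ {n} → Rel (Fin n) 0ℓ → Fin n → List (Fin n) → Fin n → Set
IsPath R x xs y = head xs ≡ just x × last xs ≡ just y × Linked R xs × Unique xs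

-- A cycle is listed with its first vertex v not repeated at the end.
IsCycle : ∀ {n} → Rel (Fin n) 0ℓ → List (Fin n) → Set
IsCycle {n} R xs = length xs ≥ 3 × Unique xs ×
  ∃₂ λ (v : Fin n) (vs : List (Fin n)) → xs ≡ v ∷ vs × Linked R (v ∷ vs ++ v ∷ [])

IsTree : ∀ {m} → Graph m → Set
IsTree {m} T =
  Fin m ×
  (∀ x y → ∃[ p ] IsPath (Adj T) x p y) ×
  (∀ c → ¬ IsCycle (Adj T) c)

IsLeaf : ∀ {m} → Graph m → Fin m → Set
IsLeaf T t = ∃! _≡_ (Adj T t)

IsAutomorphism : ∀ {n} → Graph n → Permutation′ n → Set
IsAutomorphism G α = ∀ u v → Adj G u v ⇔ Adj G (α ⟨$⟩ʳ u) (α ⟨$⟩ʳ v)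

image : ∀ {n} → Permutation′ n → Subset n → Subset n
image α X = tabulate λ v → lookup X (α ⟨$⟩ˡ v)

Maximal : ∀ {A : Set} → Rel A 0ℓ → Pred A 0ℓ → Pred A 0ℓ
Maximal _≼_ P x = P x × (∀ y → P y → x ≼ y → y ≡ x)

------------------------------------------------------------------------
-- Separations

-- Being a separation of a given graph is the separate predicate IsSeparation.
Sep : ℕ → Set
Sep n = Subset n × Subset n

module _ {n : ℕ} where

  order : Sep n → ℕ
  order (A , B) = ∣ A ∩ B ∣

  Proper : Pred (Sep n) 0ℓ
  Proper (A , B) = ¬ (A ⊆ B) × ¬ (B ⊆ A)

  infix 4 _≤ˢ_
  _≤ˢ_ : Rel (Sep n) 0ℓ
  (A , B) ≤ˢ (C , D) = A ⊆ C × D ⊆ B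

  Comparable : Rel (Sep n) 0ℓ
  Comparable s r = s ≤ˢ r ⊎ r ≤ˢ s

  Nested : Rel (Sep n) 0ℓ
  Nested s r = Comparable s r ⊎ Comparable s (swap r)

  Cross : Rel (Sep n) 0ℓ
  Cross s r = ¬ Nested s r

  infixr 6 _∨ˢ_
  _∨ˢ_ : Sep n → Sep n → Sep n
  (A , B) ∨ˢ (C , D) = (A ∪ C , B ∩ D)

  imageˢ : Permutation′ n → Sep n → Sep n
  imageˢ α (A , B) = (image α A , image α B)

  ClosedUnderInverses : Pred (Sep n) 0ℓ → Set
  ClosedUnderInverses S = ∀ s → S s → S (swap s)

  ActsOn : Permutation′ n → Pred (Sep n) 0ℓ → Set
  ActsOn α S = ∀ s → S s ⇔ S (imageˢ α s)

  Reduced : Pred (Sep n) 0ℓ → Pred (Pred (Sep n) 0ℓ) 0ℓ → Set₁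
  Reduced S 𝒫 = ∀ s → S s → ∃₂ λ P P′ → 𝒫 P × 𝒫 P′ × P s × P′ (swap s)

  Feasible : Pred (Sep n) 0ℓ → Pred (Pred (Sep n) 0ℓ) 0ℓ → Set₁
  Feasible S 𝒫 = ∀ s r → S s → S r → Cross s r →
    ∀ P P′ → 𝒫 P → 𝒫 P′ → P s → P r → P′ (swap s) → P′ (swap r) →
    ∃[ e ] P e × S e × (s ∨ˢ r) ≤ˢ e

module _ {n : ℕ} (G : Graph n) where

  IsSeparation : Pred (Sep n) 0ℓ
  IsSeparation (A , B) =
    A ∪ B ≡ ⊤ × (∀ u v → u ∈ A ─ B → v ∈ B ─ A → ¬ Adj G u v)

  Tight : Pred (Sep n) 0ℓ
  Tight (A , B) = ∀ v → v ∈ A ∩ B →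
    (∃[ a ] a ∈ A ─ B × Adj G v a) × (∃[ b ] b ∈ B ─ A × Adj G v b)

  ----------------------------------------------------------------------
  -- Blocks and their profiles

  Separates : Subset n → Fin n → Fin n → Set
  Separates W x y =
    x ∉ W × y ∉ W × (∀ p → IsPath (Adj G) x p y → Any (_∈ W) p)

  Inseparable : ℕ → Subset n → Set
  Inseparable k X = ∀ x y → x ∈ X → y ∈ X → x ≢ y →
    ¬ (∃[ W ] ∣ W ∣ < k × Separates W x y)

  IsBlock : ℕ → Subset n → Set
  IsBlock k = Maximal _⊆_ λ X → k ≤ ∣ X ∣ × Inseparable k X

  Profile : ℕ → Subset n → Pred (Sep n) 0ℓ
  Profile k X s = IsSeparation s × order s < k × X ⊆ proj₂ s

  BlockProfile : ℕ → Pred (Pred (Sep n) 0ℓ) 0ℓ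
  BlockProfile k P = ∃[ X ] IsBlock k X × P ≐ Profile k X

  WellSeparated : ℕ → Pred (Sep n) 0ℓ → Subset n → Set
  WellSeparated k S X =
    ∀ s r → Maximal _≤ˢ_ (Profile k X ∩ᵖ S) s → Maximal _≤ˢ_ (Profile k X ∩ᵖ S) r →
    Nested s r

  ----------------------------------------------------------------------
  -- Tree-decompositions

  record TreeDecomposition : Set₁ where
    field
      {m}     : ℕ
      tree    : Graph m
      isTree  : IsTree tree
      part    : Fin m → Subset n
      covers  : ∀ v → ∃[ t ] v ∈ part t
      edges   : ∀ u v → Adj G u v → ∃[ t ] u ∈ part t × v ∈ part t
      between : ∀ t₁ t₂ t₃ p → IsPath (Adj tree) t₁ p t₃ → t₂ ∈ˡ p →
                part t₁ ∩ part t₃ ⊆ part t₂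

  module _ (𝒟 : TreeDecomposition) where
    open TreeDecomposition 𝒟

    -- Adjacency in the tree with its edge t₁t₂ deleted.
    AdjWithout : Fin m → Fin m → Rel (Fin m) 0ℓ
    AdjWithout t₁ t₂ u v =
      Adj tree u v × ¬ (u ≡ t₁ × v ≡ t₂) × ¬ (u ≡ t₂ × v ≡ t₁)

    -- A is the union of the parts V_t over the component of T - t₁t₂ containing t₁.
    IsSide : Fin m → Fin m → Subset n → Set
    IsSide t₁ t₂ A = ∀ v →
      v ∈ A ⇔ (∃[ t ] (∃[ p ] IsPath (AdjWithout t₁ t₂) t₁ p t) × v ∈ part t)

    -- Inverses are included, since t₁t₂ may be taken in either direction.
    Induced : Pred (Sep n) 0ℓ
    Induced (A , B) =
      ∃₂ λ t₁ t₂ → Adj tree t₁ t₂ × IsSide t₁ t₂ A × IsSide t₂ t₁ B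

    InducedIn : Pred (Sep n) 0ℓ → Set
    InducedIn S = ∀ s → Induced s → S s

    Canonical : Pred (Sep n) 0ℓ → Set
    Canonical S = ∀ α → IsAutomorphism G α → ActsOn α S →
      ∃[ φ ] IsAutomorphism tree φ × (∀ t → image α (part t) ≡ part (φ ⟨$⟩ʳ t))

    BlocksInDifferentParts : ℕ → Set
    BlocksInDifferentParts k =
      (∀ X → IsBlock k X → ∃[ t ] X ⊆ part t) ×
      (∀ X Y → IsBlock k X → IsBlock k Y → X ≢ Y →
       ∀ s t → X ⊆ part s → Y ⊆ part t → part s ≢ part t)

    WellSeparatedBlocksAreParts : ℕ → Pred (Sep n) 0ℓ → Set
    WellSeparatedBlocksAreParts k S =
      ∀ X → IsBlock k X → WellSeparated k S X → ∀ t → X ⊆ part t → part t ≡ X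

    LeafPartsAreBlocks : ℕ → Set
    LeafPartsAreBlocks k = ∀ t → IsLeaf tree t → IsBlock k (part t)

  Refines : TreeDecomposition → TreeDecomposition → Set
  Refines 𝒟′ 𝒟 = ∀ s → Induced 𝒟 s → Induced 𝒟′ s

{-# OPTIONS --safe #-}
module Submission where

-- Any nested set N₀ ⊆ S that is invariant and distinguishes the k-blocks can be enlarged by all
-- separations in S that are nested with the whole of S. For a well separated block X these include
-- the maximal elements of P_k(X) ∩ S, which cut X out exactly because every vertex outside X is
-- separated from X by a tight separation; if the task is reduced and feasible they also include the
-- maximal elements of S, so that the separation at a leaf is maximal in S and its block is well
-- separated. A nested set of proper separations is turned into a tree canonically: the nodes are its
-- consistent orientations, two of them adjacent if they differ in a single separation, and the part
-- of an orientation is the intersection of the sides it points to.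
--
-- For N₀ one takes the separations induced by the given tree-decomposition or, if none is given, for
-- every pair of blocks the separations distinguishing them that have least order and, subject to
-- this, cross as few separations as possible. Both quantities are submodular and the second one
-- strictly so on crossing pairs, hence two such separations cannot cross.

open import Defs
open import Algebra.Properties.CommutativeSemigroup using (interchange)
open import Data.Bool.Base using (Bool; true; false; if_then_else_; _∧_; _∨_)
open import Data.Bool.Properties using () renaming (_≟_ to _≟ᵇ_)
open import Data.Empty as Empty using (⊥-elim)
open import Data.Fin.Base using (Fin; zero; suc)
open import Data.Fin.Permutation using (Permutation′; _⟨$⟩ʳ_; _⟨$⟩ˡ_; inverseˡ; inverseʳ; permutation; flip)
import Data.Fin.Properties as Fin
open import Data.Fin.Subset
open import Data.Fin.Subset.Induction using (⊃-wellFounded; ⊂-wellFounded)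
open import Data.Fin.Subset.Properties
open import Data.List.Base using (List; []; _∷_; _++_; length)
open import Data.List.Membership.Propositional using () renaming (_∈_ to _∈ˡ_; _∉_ to _∉ˡ_)
import Data.List.Membership.DecPropositional as DecMembership
open import Data.List.Relation.Unary.All using (All; []; _∷_)
open import Data.List.Relation.Unary.All.Properties using (¬Any⇒All¬; All¬⇒¬Any)
open import Data.List.Relation.Unary.AllPairs using ([]; _∷_)
open import Data.List.Relation.Unary.Any as Any using (Any; here; there)
open import Data.List.Relation.Unary.Linked using (Linked; []; [-]; _∷_)
open import Data.Nat.Base as ℕ using (ℕ; zero; suc; _≤_; _<_; _+_; _*_; s≤s; z≤n)
open import Data.Nat.Induction using (<-wellFounded)
import Data.Nat.Properties as ℕ
open import Data.Product.Base using (_×_; _,_; ∃; ∃-syntax; ∃₂; proj₁; proj₂; swap)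
open import Data.Product.Function.NonDependent.Propositional using (_×-↔_)
open import Data.Product.Properties using (≡-dec)
open import Data.Sum.Base as Sum using (_⊎_; inj₁; inj₂)
open import Data.Vec.Base as Vec using (Vec; []; _∷_; tabulate; lookup)
import Data.Vec.Properties as Vec
open import Function.Base using (_∘_; id; case_of_)
open import Function.Bundles using (_⇔_; _↔_; mk↔ₛ′; mk⇔; Inverse; Equivalence)
open import Function.Construct.Composition using (_↔-∘_)
open import Function.Construct.Symmetry using (↔-sym)
open import Induction.WellFounded using (Acc; acc)
open import Level using (Level; 0ℓ)
open import Relation.Binary.Construct.Closure.ReflexiveTransitive using (Star; ε; _◅_; _◅◅_; gmap; reverse)
open import Relation.Binary.Core using (Rel)
import Relation.Binary.Definitions as Binary
open import Relation.Binary.PropositionalEquality.Core using (_≡_; _≢_; refl; sym; trans; cong; cong₂; subst; subst₂)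
open import Relation.Nullary using (¬_; Dec; yes; no; does; contradiction)
open import Relation.Nullary.Decidable using (map′; _×-dec_; _⊎-dec_; _→-dec_; ¬?; decidable-stable; toWitness; dec-true; dec-false)
open import Relation.Unary using (Pred; Decidable)
open import Algebra.Properties.CommutativeMonoid.Sum ℕ.+-0-commutativeMonoid
  using (sum; sum-permute; sum-cong-≗; ∑-distrib-+)

-- Canonicity forbids choosing one separation for each pair of blocks, so all optimal ones are
-- taken, for all pairs. Those of least order can cross each other, and submodularity of the order
-- alone gives no contradiction when corners are compared with the two crossing separations; the
-- strictness of the second criterion supplies it. Corners of elements of `S` may fall outside `S`.
-- Optimality is therefore meant among all separations of the graph, and membership in `S` is
-- recovered afterwards: a distinguisher of least order is tight. Crossings are likewise counted
-- against all pairs of vertex sets, which makes the count independent of `S` and invariant under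
-- every permutation of the vertices. All objects involved are finite and `S` is decidable, so
-- minima, maxima and orientations are found by search.

private variable
  ℓ : Level
  A : Set
  n : ℕ

-- Search in finite types

Finite : Set → Set
Finite A = ∃ λ k → A ↔ Fin k

finite-× : ∀ {B : Set} → Finite A → Finite B → Finite (A × B)
finite-× (_ , f) (_ , g) = _ , ↔-sym Fin.*↔× ↔-∘ (f ×-↔ g)

abstract
  finite-Subset : ∀ n → Finite (Subset n)
  finite-Subset zero    = 1 , mk↔ₛ′ (λ _ → zero) (λ _ → []) (λ { zero → refl }) (λ { [] → refl })
  finite-Subset (suc n) with finite-× (2 , ↔-sym Fin.2↔Bool) (finite-Subset n)
  ... | k , f = k , f ↔-∘ mk↔ₛ′ (λ p → Vec.head p , Vec.tail p) (λ (x , p) → x ∷ p)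
                                (λ _ → refl) (λ { (_ ∷ _) → refl })

finite-Sep : Finite (Sep n)
finite-Sep {n} = finite-× (finite-Subset n) (finite-Subset n)

module _ (finite : Finite A) where
  open Inverse (proj₂ finite)

  any? : {P : Pred A ℓ} → Decidable P → Dec (∃ P)
  any? {P = P} P? = map′ (λ (i , p) → from i , p)
    (λ (a , p) → to a , subst P (sym (strictlyInverseʳ a)) p)
    (Fin.any? (P? ∘ from))

  all? : {P : Pred A ℓ} → Decidable P → Dec (∀ a → P a)
  all? {P = P} P? = map′ (λ h a → subst P (strictlyInverseʳ a) (h (to a)))
    (λ h i → h (from i)) (Fin.all? (P? ∘ from))

  argmin : {P : Pred A ℓ} → Decidable P → (μ : A → ℕ) → ∃ P →
           ∃ λ a → P a × (∀ b → P b → μ a ≤ μ b)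
  argmin {P = P} P? μ (a , p) = go a p (<-wellFounded (μ a))
    where
    go : ∀ a → P a → Acc _<_ (μ a) → ∃ λ a → P a × (∀ b → P b → μ a ≤ μ b)
    go a p (acc rec) with any? (λ b → P? b ×-dec (μ b ℕ.<? μ a))
    ... | yes (b , q , b<a) = go b q (rec b<a)
    ... | no ∄b = a , p , λ b q → ℕ.≮⇒≥ λ b<a → ∄b (b , q , b<a)

  -- The list has no repetitions because the nodes of the tree will be indices into such a list, and
  -- equal orientations must get equal indices.
  enumerate : {P : Pred A ℓ} → Decidable P →
    ∃₂ λ m (g : Fin m → A) → (∀ {i j} → g i ≡ g j → i ≡ j) × (∀ i → P (g i)) × (∀ a → P a → ∃ λ i → g i ≡ a)
  enumerate {P = P} P? with go (proj₁ finite) {P ∘ from} (P? ∘ from)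
    where
    go : ∀ k {Q : Pred (Fin k) ℓ} → Decidable Q →
      ∃₂ λ m (g : Fin m → Fin k) → (∀ {i j} → g i ≡ g j → i ≡ j) × (∀ i → Q (g i)) ×
          (∀ a → Q a → ∃ λ i → g i ≡ a)
    go zero Q? = 0 , (λ ()) , (λ { {()} }) , (λ ()) , (λ ())
    go (suc k) Q? with go k (Q? ∘ suc) | Q? zero
    ... | m , g , inj , sound , complete | no ¬q0 =
      m , suc ∘ g , inj ∘ Fin.suc-injective , sound ,
      λ { zero q → contradiction q ¬q0 ; (suc a) q → let i , e = complete a q in i , cong suc e }
    ... | m , g , inj , sound , complete | yes q0 =
      suc m , (λ { zero → zero ; (suc i) → suc (g i) }) ,
      (λ { {zero} {zero} _ → refl ; {suc i} {suc j} e → cong suc (inj (Fin.suc-injective e)) }) ,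
      (λ { zero → q0 ; (suc i) → sound i }) ,
      λ { zero q → zero , refl ; (suc a) q → let i , e = complete a q in suc i , cong suc e }
  ... | m , g , inj , sound , complete =
    m , from ∘ g , (λ e →
        inj (trans (sym (strictlyInverseˡ _)) (trans (cong to e) (strictlyInverseˡ _)))) , sound ,
    λ a p → let i , e = complete (to a) (subst P (sym (strictlyInverseʳ a)) p)
            in i , trans (cong from e) (strictlyInverseʳ a)

comprehension : {P : Pred (Fin n) ℓ} → Decidable P → Subset n
comprehension P? = tabulate (does ∘ P?)

module _ {P : Pred (Fin n) ℓ} (P? : Decidable P) where

  ∈comprehension⁺ : ∀ {x} → P x → x ∈ comprehension P?
  ∈comprehension⁺ {x} p = Vec.lookup⇒[]= x _
    (trans (Vec.lookup∘tabulate (does ∘ P?) x) (dec-true (P? x) p))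

  ∈comprehension⁻ : ∀ {x} → x ∈ comprehension P? → P x
  ∈comprehension⁻ {x} m with P? x in eq
  ... | yes p = p
  ... | no ¬p with trans (sym (Vec.[]=⇒lookup m)) (trans (Vec.lookup∘tabulate (does ∘ P?) x) (cong does eq))
  ... | ()

x∈p─q⇒x∉q : (p q : Subset n) → ∀ {x} → x ∈ p ─ q → x ∉ q
x∈p─q⇒x∉q (_ ∷ p) (_ ∷ q)      (Vec.there x∈) (Vec.there x∈q) = x∈p─q⇒x∉q p q x∈ x∈q
x∈p─q⇒x∉q (_ ∷ p) (inside ∷ q) () Vec.here

_≟ᵛ_ : (X Y : Subset n) → Dec (X ≡ Y)
_≟ᵛ_ = Vec.≡-dec _≟ᵇ_

_≟ˢ_ : (s r : Sep n) → Dec (s ≡ r)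
_≟ˢ_ = ≡-dec _≟ᵛ_ _≟ᵛ_

_≤ˢ?_ : (s r : Sep n) → Dec (s ≤ˢ r)
(A , B) ≤ˢ? (C , D) = A ⊆? C ×-dec D ⊆? B

abstract
  nested? : (s r : Sep n) → Dec (Nested s r)
  nested? s r = (s ≤ˢ? r ⊎-dec r ≤ˢ? s) ⊎-dec (s ≤ˢ? swap r ⊎-dec swap r ≤ˢ? s)

-- Separations

≤ˢ-refl : (s : Sep n) → s ≤ˢ s
≤ˢ-refl _ = id , id

≤ˢ-trans : {s r t : Sep n} → s ≤ˢ r → r ≤ˢ t → s ≤ˢ t
≤ˢ-trans (a , b) (c , d) = (λ x → c (a x)) , (λ x → b (d x))

≤ˢ-antisym : {s r : Sep n} → s ≤ˢ r → r ≤ˢ s → s ≡ r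
≤ˢ-antisym (a , b) (c , d) = cong₂ _,_ (⊆-antisym a c) (⊆-antisym d b)

swap-≤ˢ : {s r : Sep n} → s ≤ˢ r → swap r ≤ˢ swap s
swap-≤ˢ (a , b) = b , a

nested-swapʳ : {s r : Sep n} → Nested s r → Nested s (swap r)
nested-swapʳ = Sum.swap

nested-swapˡ : {s r : Sep n} → Nested s r → Nested (swap s) r
nested-swapˡ (inj₁ (inj₁ h)) = inj₂ (inj₂ (swap-≤ˢ h))
nested-swapˡ (inj₁ (inj₂ h)) = inj₂ (inj₁ (swap-≤ˢ h))
nested-swapˡ (inj₂ (inj₁ h)) = inj₁ (inj₂ (swap-≤ˢ h))
nested-swapˡ (inj₂ (inj₂ h)) = inj₁ (inj₁ (swap-≤ˢ h))

nested-sym : {s r : Sep n} → Nested s r → Nested r s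
nested-sym (inj₁ h) = inj₁ (Sum.swap h)
nested-sym (inj₂ (inj₁ h)) = inj₂ (inj₁ (swap-≤ˢ h))
nested-sym (inj₂ (inj₂ h)) = inj₂ (inj₂ (swap-≤ˢ h))

module _ {n} (G : Graph n) where

  isSeparation⁺ : ∀ {s} → (∀ v → v ∈ proj₁ s ⊎ v ∈ proj₂ s) →
    (∀ {u v} → u ∉ proj₂ s → v ∉ proj₁ s → ¬ Adj G u v) → IsSeparation G s
  isSeparation⁺ {A , B} cover edge =
    ⊆-antisym (λ _ → ∈⊤) (λ {v} _ → x∈p∪q⁺ (cover v)) ,
    λ u v u∈ v∈ → edge (x∈p─q⇒x∉q A B u∈) (x∈p─q⇒x∉q B A v∈)

  cover : ∀ {s} → IsSeparation G s → ∀ v → v ∈ proj₁ s ⊎ v ∈ proj₂ s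
  cover {A , B} (e , _) v = x∈p∪q⁻ A B (subst (v ∈_) (sym e) ∈⊤)

  ∉proj₂⇒∈proj₁ : ∀ {s} → IsSeparation G s → ∀ {v} → v ∉ proj₂ s → v ∈ proj₁ s
  ∉proj₂⇒∈proj₁ sep {v} v∉ with cover sep v
  ... | inj₁ v∈ = v∈
  ... | inj₂ v∈ = contradiction v∈ v∉

  ∉proj₁⇒∈proj₂ : ∀ {s} → IsSeparation G s → ∀ {v} → v ∉ proj₁ s → v ∈ proj₂ s
  ∉proj₁⇒∈proj₂ sep {v} v∉ with cover sep v
  ... | inj₁ v∈ = contradiction v∈ v∉
  ... | inj₂ v∈ = v∈

  no-edge : ∀ {s} → IsSeparation G s → ∀ {u v} → u ∉ proj₂ s → v ∉ proj₁ s → ¬ Adj G u v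
  no-edge sep u∉ v∉ = proj₂ sep _ _ (x∈p∧x∉q⇒x∈p─q (∉proj₂⇒∈proj₁ sep u∉) u∉)
      (x∈p∧x∉q⇒x∈p─q (∉proj₁⇒∈proj₂ sep v∉) v∉)

  isSeparation-swap : ∀ {s} → IsSeparation G s → IsSeparation G (swap s)
  isSeparation-swap sep = isSeparation⁺ (Sum.swap ∘ cover sep)
    (λ u∉ v∉ e → no-edge sep v∉ u∉ (Graph.sym G e))

  isSeparation? : Decidable (IsSeparation G)
  isSeparation? (A , B) = (A ∪ B) ≟ᵛ ⊤ ×-dec
    Fin.all? (λ u → Fin.all? λ v → u ∈? (A ─ B) →-dec (v ∈? (B ─ A) →-dec ¬? (Graph.adj? G u v)))

  ∨ˢ-isSeparation : ∀ {s r} → IsSeparation G s → IsSeparation G r → IsSeparation G (s ∨ˢ r)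
  ∨ˢ-isSeparation {A , B} {C , D} hs hr = isSeparation⁺ cov edge
    where
    cov : ∀ v → v ∈ A ∪ C ⊎ v ∈ B ∩ D
    cov v with cover hs v | cover hr v
    ... | inj₁ a | _ = inj₁ (x∈p∪q⁺ (inj₁ a))
    ... | inj₂ _ | inj₁ c = inj₁ (x∈p∪q⁺ (inj₂ c))
    ... | inj₂ b | inj₂ d = inj₂ (x∈p∩q⁺ (b , d))
    edge : ∀ {u v} → u ∉ B ∩ D → v ∉ A ∪ C → ¬ Adj G u v
    edge {u} u∉ v∉ e with u ∈? B
    ... | no u∉B = no-edge hs u∉B (v∉ ∘ x∈p∪q⁺ ∘ inj₁) e
    ... | yes u∈B = no-edge hr (λ u∈D → u∉ (x∈p∩q⁺ (u∈B , u∈D))) (v∉ ∘ x∈p∪q⁺ ∘ inj₂) e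

order-swap : (s : Sep n) → order (swap s) ≡ order s
order-swap (A , B) = cong ∣_∣ (∩-comm B A)

-- Images under permutations

module _ (α : Permutation′ n) where

  ∈image⁺ : ∀ {X v} → α ⟨$⟩ˡ v ∈ X → v ∈ image α X
  ∈image⁺ {X} {v} h = Vec.lookup⇒[]= v _ (trans (Vec.lookup∘tabulate _ v) (Vec.[]=⇒lookup h))

  ∈image⁻ : ∀ {X v} → v ∈ image α X → α ⟨$⟩ˡ v ∈ X
  ∈image⁻ {X} {v} h = Vec.lookup⇒[]= _ X (trans (sym (Vec.lookup∘tabulate _ v)) (Vec.[]=⇒lookup h))

  image-mono : ∀ {X Y} → X ⊆ Y → image α X ⊆ image α Y
  image-mono h = ∈image⁺ ∘ h ∘ ∈image⁻

  image-flip : ∀ X → image α (image (flip α) X) ≡ X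
  image-flip X = ⊆-antisym
    (λ {v} h → subst (_∈ X) (inverseʳ α) (∈image⁻′ (∈image⁻ h)))
    (λ {v} h → ∈image⁺ (∈image⁺′ (subst (_∈ X) (sym (inverseʳ α)) h)))
    where
    ∈image⁻′ : ∀ {v} → v ∈ image (flip α) X → α ⟨$⟩ʳ v ∈ X
    ∈image⁻′ {v} h = Vec.lookup⇒[]= _ X (trans (sym (Vec.lookup∘tabulate _ v)) (Vec.[]=⇒lookup h))
    ∈image⁺′ : ∀ {v} → α ⟨$⟩ʳ v ∈ X → v ∈ image (flip α) X
    ∈image⁺′ {v} h = Vec.lookup⇒[]= v _ (trans (Vec.lookup∘tabulate _ v) (Vec.[]=⇒lookup h))

  image-∩ : ∀ X Y → image α (X ∩ Y) ≡ image α X ∩ image α Y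
  image-∩ X Y = ⊆-antisym
    (λ h → let a , b = x∈p∩q⁻ X Y (∈image⁻ h) in x∈p∩q⁺ (∈image⁺ a , ∈image⁺ b))
    (λ h → let a , b = x∈p∩q⁻ (image α X) (image α Y) h in ∈image⁺ {X ∩ Y} (x∈p∩q⁺ (∈image⁻ a , ∈image⁻ b)))

  imageˢ-flip : ∀ s → imageˢ α (imageˢ (flip α) s) ≡ s
  imageˢ-flip (A , B) = cong₂ _,_ (image-flip A) (image-flip B)

  imageˢ-mono : ∀ {s r} → s ≤ˢ r → imageˢ α s ≤ˢ imageˢ α r
  imageˢ-mono (a , b) = image-mono a , image-mono b

  imageˢ-nested : ∀ {s r} → Nested s r → Nested (imageˢ α s) (imageˢ α r)
  imageˢ-nested = Sum.map (Sum.map imageˢ-mono imageˢ-mono) (Sum.map imageˢ-mono imageˢ-mono)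

flip-imageˢ : ∀ (α : Permutation′ n) s → imageˢ (flip α) (imageˢ α s) ≡ s
flip-imageˢ α s = imageˢ-flip (flip α) s

flip-image : ∀ (α : Permutation′ n) X → image (flip α) (image α X) ≡ X
flip-image α X = image-flip (flip α) X

⊆image-flip⁺ : ∀ (α : Permutation′ n) {X Y} → image α X ⊆ Y → X ⊆ image (flip α) Y
⊆image-flip⁺ α {X} h {v} v∈ = image-mono (flip α) h (subst (v ∈_) (sym (flip-image α X)) v∈)

⊆image-flip⁻ : ∀ (α : Permutation′ n) {X Y} → X ⊆ image (flip α) Y → image α X ⊆ Y
⊆image-flip⁻ α {X} {Y} h {v} v∈ = subst (v ∈_) (image-flip α Y) (image-mono α h v∈)

module _ {n} (G : Graph n) (α : Permutation′ n) (auto : IsAutomorphism G α) where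

  flip-isAutomorphism : IsAutomorphism G (flip α)
  flip-isAutomorphism u v = mk⇔
    (λ e → Equivalence.from (auto _ _) (subst (λ x → Adj G x _) (sym (inverseʳ α))
        (subst (Adj G u) (sym (inverseʳ α)) e)))
    (λ e → subst (λ x → Adj G x v) (inverseʳ α) (subst (Adj G _) (inverseʳ α) (Equivalence.to (auto _ _) e)))

  imageˢ-isSeparation : ∀ {s} → IsSeparation G s → IsSeparation G (imageˢ α s)
  imageˢ-isSeparation sep = isSeparation⁺ G
    (λ v → Sum.map (∈image⁺ α) (∈image⁺ α) (cover G sep (α ⟨$⟩ˡ v)))
    (λ u∉ v∉ e → no-edge G sep (u∉ ∘ ∈image⁺ α) (v∉ ∘ ∈image⁺ α) (Equivalence.to (flip-isAutomorphism _ _) e))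

-- Cardinalities as sums and submodularity of the order

sum-mono : ∀ {k} {f g : Fin k → ℕ} → (∀ i → f i ≤ g i) → sum f ≤ sum g
sum-mono {zero}  h = z≤n
sum-mono {suc k} h = ℕ.+-mono-≤ (h zero) (sum-mono (h ∘ suc))

sum-mono-< : ∀ {k} {f g : Fin k → ℕ} → (∀ i → f i ≤ g i) → ∀ i → f i < g i → sum f < sum g
sum-mono-< {suc k} h zero    h< = ℕ.+-mono-<-≤ h< (sum-mono (h ∘ suc))
sum-mono-< {suc k} h (suc i) h< = ℕ.+-mono-≤-< (h zero) (sum-mono-< (h ∘ suc) i h<)

sum≤size : ∀ {k} {f : Fin k → ℕ} → (∀ i → f i ≤ 1) → sum f ≤ k
sum≤size {zero}  h = z≤n
sum≤size {suc k} h = ℕ.+-mono-≤ (h zero) (sum≤size (h ∘ suc))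

𝟙 : Bool → ℕ
𝟙 b = if b then 1 else 0

∣∣≡sum : (X : Subset n) → ∣ X ∣ ≡ sum (𝟙 ∘ lookup X)
∣∣≡sum []            = refl
∣∣≡sum (inside ∷ X)  = cong suc (∣∣≡sum X)
∣∣≡sum (outside ∷ X) = ∣∣≡sum X

∣image∣ : (α : Permutation′ n) (X : Subset n) → ∣ image α X ∣ ≡ ∣ X ∣
∣image∣ α X = trans (∣∣≡sum (image α X)) (trans
  (sum-cong-≗ (λ i → cong 𝟙 (Vec.lookup∘tabulate (λ v → lookup X (α ⟨$⟩ˡ v)) i)))
  (trans (sym (sum-permute (𝟙 ∘ lookup X) (flip α))) (sym (∣∣≡sum X))))

order-imageˢ : (α : Permutation′ n) (s : Sep n) → order (imageˢ α s) ≡ order s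
order-imageˢ α (A , B) = trans (cong ∣_∣ (sym (image-∩ α A B))) (∣image∣ α (A ∩ B))

-- Opposite corners are s ∨ˢ r and the inverse of swap s ∨ˢ swap r.
order-submodular : (s r : Sep n) → order (s ∨ˢ r) + order (swap s ∨ˢ swap r) ≤ order s + order r
order-submodular s@(A , B) r@(C , D) = begin
  order (s ∨ˢ r) + order (swap s ∨ˢ swap r)
    ≡⟨ cong₂ _+_ (∣∣≡sum ((A ∪ C) ∩ (B ∩ D))) (∣∣≡sum ((B ∪ D) ∩ (A ∩ C))) ⟩
  sum (𝟙 ∘ lookup ((A ∪ C) ∩ (B ∩ D))) + sum (𝟙 ∘ lookup ((B ∪ D) ∩ (A ∩ C)))
    ≡⟨ ∑-distrib-+ (𝟙 ∘ lookup ((A ∪ C) ∩ (B ∩ D))) (𝟙 ∘ lookup ((B ∪ D) ∩ (A ∩ C))) ⟨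
  sum (λ i → 𝟙 (lookup ((A ∪ C) ∩ (B ∩ D)) i) + 𝟙 (lookup ((B ∪ D) ∩ (A ∩ C)) i))
    ≤⟨ sum-mono pointwise ⟩
  sum (λ i → 𝟙 (lookup (A ∩ B) i) + 𝟙 (lookup (C ∩ D) i))  ≡⟨ ∑-distrib-+ (𝟙 ∘ lookup (A ∩ B))
      (𝟙 ∘ lookup (C ∩ D)) ⟩
  sum (𝟙 ∘ lookup (A ∩ B)) + sum (𝟙 ∘ lookup (C ∩ D))      ≡⟨ cong₂ _+_ (∣∣≡sum (A ∩ B)) (∣∣≡sum (C ∩ D)) ⟨
  order s + order r ∎
  where
  open ℕ.≤-Reasoning
  allᵇ? = all? (2 , ↔-sym Fin.2↔Bool)

  -- A vertex contributes according to its four memberships, so sixteen cases are evaluated. For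
  -- arbitrary pairs of sets this is only an inequality, since a vertex may lie on neither side.
  bits : ∀ a b c d → 𝟙 ((a ∨ c) ∧ (b ∧ d)) + 𝟙 ((b ∨ d) ∧ (a ∧ c)) ≤ 𝟙 (a ∧ b) + 𝟙 (c ∧ d)
  bits = toWitness {a? = allᵇ? λ a → allᵇ? λ b → allᵇ? λ c → allᵇ? λ d →
    𝟙 ((a ∨ c) ∧ (b ∧ d)) + 𝟙 ((b ∨ d) ∧ (a ∧ c)) ℕ.≤? 𝟙 (a ∧ b) + 𝟙 (c ∧ d)} _

  pointwise : ∀ i → 𝟙 (lookup ((A ∪ C) ∩ (B ∩ D)) i) + 𝟙 (lookup ((B ∪ D) ∩ (A ∩ C)) i)
                  ≤ 𝟙 (lookup (A ∩ B) i) + 𝟙 (lookup (C ∩ D) i)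
  pointwise i
    rewrite Vec.lookup-zipWith _∧_ i (A ∪ C) (B ∩ D) | Vec.lookup-zipWith _∨_ i A C
          | Vec.lookup-zipWith _∧_ i B D | Vec.lookup-zipWith _∧_ i (B ∪ D) (A ∩ C)
          | Vec.lookup-zipWith _∨_ i B D | Vec.lookup-zipWith _∧_ i A C
          | Vec.lookup-zipWith _∧_ i A B | Vec.lookup-zipWith _∧_ i C D
    = bits (lookup A i) (lookup B i) (lookup C i) (lookup D i)

-- Corners of crossing separations

≤ˢ-∨ˢˡ : (s r : Sep n) → s ≤ˢ s ∨ˢ r
≤ˢ-∨ˢˡ (A , B) (C , D) = p⊆p∪q C , p∩q⊆p B D

≤ˢ-∨ˢʳ : (s r : Sep n) → r ≤ˢ s ∨ˢ r
≤ˢ-∨ˢʳ (A , B) (C , D) = q⊆p∪q A C , p∩q⊆q B D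

∨ˢ-least : (s r : Sep n) {t : Sep n} → s ≤ˢ t → r ≤ˢ t → s ∨ˢ r ≤ˢ t
∨ˢ-least (A , B) (C , D) (a , b) (c , d) =
  (λ h → Sum.[ a , c ] (x∈p∪q⁻ A C h)) , (λ h → x∈p∩q⁺ (b h , d h))

-- The "fish lemma". If `t` or its inverse lies below `s` or `r`, it lies below their supremum; if
-- `s` and `r` both lie below `t`, or both below its inverse, so does the supremum. The mixed case
-- would give `s ≤ˢ swap r` and contradict crossing.
nested-∨ˢ : {s r : Sep n} (t : Sep n) → Cross s r → Nested t s → Nested t r → Nested t (s ∨ˢ r)
nested-∨ˢ {s = s} {r} t cross = go
  where
  above : ∀ {t} → t ≤ˢ s ⊎ t ≤ˢ r → t ≤ˢ s ∨ˢ r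
  above (inj₁ h) = ≤ˢ-trans h (≤ˢ-∨ˢˡ s r)
  above (inj₂ h) = ≤ˢ-trans h (≤ˢ-∨ˢʳ s r)

  go : Nested t s → Nested t r → Nested t (s ∨ˢ r)
  go (inj₁ (inj₁ t≤s)) _ = inj₁ (inj₁ (above (inj₁ t≤s)))
  go _ (inj₁ (inj₁ t≤r)) = inj₁ (inj₁ (above (inj₂ t≤r)))
  go (inj₂ (inj₂ s*≤t)) _ = inj₂ (inj₂ (swap-≤ˢ (above {swap t} (inj₁ (swap-≤ˢ s*≤t)))))
  go _ (inj₂ (inj₂ r*≤t)) = inj₂ (inj₂ (swap-≤ˢ (above {swap t} (inj₂ (swap-≤ˢ r*≤t)))))
  go (inj₁ (inj₂ s≤t)) (inj₁ (inj₂ r≤t)) = inj₁ (inj₂ (∨ˢ-least s r s≤t r≤t))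
  go (inj₂ (inj₁ t≤s*)) (inj₂ (inj₁ t≤r*)) = inj₂ (inj₁ (swap-≤ˢ (∨ˢ-least s r (swap-≤ˢ t≤s*) (swap-≤ˢ t≤r*))))
  go (inj₁ (inj₂ s≤t)) (inj₂ (inj₁ t≤r*)) = contradiction (inj₂ (inj₁ (≤ˢ-trans s≤t t≤r*))) cross
  go (inj₂ (inj₁ t≤s*)) (inj₁ (inj₂ r≤t)) = contradiction (inj₂ (inj₁ (swap-≤ˢ (≤ˢ-trans r≤t t≤s*)))) cross

-- Up to inverting `t`, it lies below `s` or below `swap s`, and each of these lies below one of the
-- two corners.
nested-corner : {s : Sep n} (r t : Sep n) → Nested t s → Nested t (s ∨ˢ r) ⊎ Nested t (swap s ∨ˢ swap r)
nested-corner {s = s} r t (inj₁ (inj₁ h)) = inj₁ (inj₁ (inj₁ (≤ˢ-trans h (≤ˢ-∨ˢˡ s r))))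
nested-corner {s = s} r t (inj₁ (inj₂ h)) = inj₂ (inj₂ (inj₂ (≤ˢ-trans (swap-≤ˢ (≤ˢ-∨ˢˡ (swap s) (swap r))) h)))
nested-corner {s = s} r t (inj₂ (inj₁ h)) = inj₂ (inj₁ (inj₁ (≤ˢ-trans h (≤ˢ-∨ˢˡ (swap s) (swap r)))))
nested-corner {s = s} r t (inj₂ (inj₂ h)) = inj₁ (inj₂ (inj₂ (≤ˢ-trans (swap-≤ˢ (≤ˢ-∨ˢˡ s r)) h)))

cross-swap : {s r : Sep n} → Cross s r → Cross (swap s) (swap r)
cross-swap c h = c (nested-swapˡ (nested-swapʳ h))

-- Crossing numbers and weights

crosses : Sep n → Sep n → ℕ
crosses t s = if does (nested? t s) then 0 else 1

nested⇒crosses : {t s : Sep n} → Nested t s → crosses t s ≡ 0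
nested⇒crosses {t = t} {s} h rewrite dec-true (nested? t s) h = refl

cross⇒crosses : {t s : Sep n} → Cross t s → crosses t s ≡ 1
cross⇒crosses {t = t} {s} h rewrite dec-false (nested? t s) h = refl

crosses≤1 : (t s : Sep n) → crosses t s ≤ 1
crosses≤1 t s with does (nested? t s)
... | true  = z≤n
... | false = ℕ.≤-refl

crosses-⇔ : {t s t′ s′ : Sep n} → (Nested t s → Nested t′ s′) → (Nested t′ s′ → Nested t s) →
    crosses t s ≡ crosses t′ s′
crosses-⇔ {t = t} {s} f g with nested? t s
... | yes h = sym (nested⇒crosses (f h))
... | no ¬h = sym (cross⇒crosses (¬h ∘ g))

-- By `nested-∨ˢ` a `t` nested with both crosses no corner, and by `nested-corner` a `t` nested with
-- one of them crosses at most one corner.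
crosses-submodular : {s r : Sep n} → Cross s r → ∀ t →
  crosses t (s ∨ˢ r) + crosses t (swap s ∨ˢ swap r) ≤ crosses t s + crosses t r
crosses-submodular {s = s} {r} c t = go (nested? t s) (nested? t r)
  where
  one : Nested t (s ∨ˢ r) ⊎ Nested t (swap s ∨ˢ swap r) → crosses t (s ∨ˢ r) + crosses t (swap s ∨ˢ swap r) ≤ 1
  one (inj₁ h) = ℕ.+-mono-≤ (ℕ.≤-reflexive (nested⇒crosses h)) (crosses≤1 t (swap s ∨ˢ swap r))
  one (inj₂ h) = ℕ.+-mono-≤ (crosses≤1 t (s ∨ˢ r)) (ℕ.≤-reflexive (nested⇒crosses h))

  ∨ˢ-comm : (s r : Sep _) → s ∨ˢ r ≡ r ∨ˢ s
  ∨ˢ-comm (A , B) (C , D) = cong₂ _,_ (∪-comm A C) (∩-comm B D)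

  comm : Nested t (r ∨ˢ s) ⊎ Nested t (swap r ∨ˢ swap s) → Nested t (s ∨ˢ r) ⊎ Nested t (swap s ∨ˢ swap r)
  comm = Sum.map (subst (Nested t) (∨ˢ-comm r s)) (subst (Nested t) (∨ˢ-comm (swap r) (swap s)))

  go : Dec (Nested t s) → Dec (Nested t r) →
    crosses t (s ∨ˢ r) + crosses t (swap s ∨ˢ swap r) ≤ crosses t s + crosses t r
  go (yes a) (yes b) = ℕ.≤-reflexive (trans
    (cong₂ _+_ (nested⇒crosses (nested-∨ˢ t c a b))
               (nested⇒crosses (nested-∨ˢ t (cross-swap c) (nested-swapʳ a) (nested-swapʳ b))))
    (sym (cong₂ _+_ (nested⇒crosses a) (nested⇒crosses b))))
  go (yes a) (no b) = ℕ.≤-trans (one (nested-corner r t a))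
    (ℕ.≤-reflexive (sym (cong₂ _+_ (nested⇒crosses a) (cross⇒crosses b))))
  go (no a) (yes b) = ℕ.≤-trans (one (comm (nested-corner s t b)))
    (ℕ.≤-reflexive (sym (cong₂ _+_ (cross⇒crosses a) (nested⇒crosses b))))
  go (no a) (no b) = ℕ.≤-trans (ℕ.+-mono-≤ (crosses≤1 t (s ∨ˢ r)) (crosses≤1 t (swap s ∨ˢ swap r)))
    (ℕ.≤-reflexive (sym (cong₂ _+_ (cross⇒crosses a) (cross⇒crosses b))))

module _ {n : ℕ} where
  private
    size = proj₁ (finite-Sep {n})
    sepAt = Inverse.from (proj₂ (finite-Sep {n}))
    indexOf = Inverse.to (proj₂ (finite-Sep {n}))
    sepAt-indexOf = Inverse.strictlyInverseʳ (proj₂ (finite-Sep {n}))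

  crossingNumber : Sep n → ℕ
  crossingNumber s = sum (λ i → crosses (sepAt i) s)

  -- Strict because of the summand for `s` itself, which crosses `r` but is nested with both
  -- corners.
  crossingNumber-submodular : {s r : Sep n} → Cross s r →
    crossingNumber (s ∨ˢ r) + crossingNumber (swap s ∨ˢ swap r) < crossingNumber s + crossingNumber r
  crossingNumber-submodular {s} {r} c = begin-strict
    crossingNumber (s ∨ˢ r) + crossingNumber (swap s ∨ˢ swap r) ≡⟨ ∑-distrib-+
        (λ i → crosses (sepAt i) (s ∨ˢ r)) (λ i → crosses (sepAt i) (swap s ∨ˢ swap r)) ⟨
    sum (λ i → crosses (sepAt i) (s ∨ˢ r) + crosses (sepAt i) (swap s ∨ˢ swap r))
      <⟨ sum-mono-< (crosses-submodular c ∘ sepAt) (indexOf s) decrease ⟩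
    sum (λ i → crosses (sepAt i) s + crosses (sepAt i) r) ≡⟨ ∑-distrib-+ (λ i → crosses (sepAt i) s)
        (λ i → crosses (sepAt i) r) ⟩
    crossingNumber s + crossingNumber r ∎
    where
    open ℕ.≤-Reasoning
    decrease : crosses (sepAt (indexOf s)) (s ∨ˢ r) + crosses (sepAt (indexOf s)) (swap s ∨ˢ swap r)
           < crosses (sepAt (indexOf s)) s + crosses (sepAt (indexOf s)) r
    decrease = subst
      (λ t → crosses t (s ∨ˢ r) + crosses t (swap s ∨ˢ swap r) < crosses t s + crosses t r)
      (sym (sepAt-indexOf s))
      (ℕ.≤-trans (s≤s (ℕ.≤-reflexive (cong₂ _+_
        (nested⇒crosses (inj₁ (inj₁ (≤ˢ-∨ˢˡ s r))))
        (nested⇒crosses (inj₂ (inj₂ (swap-≤ˢ (≤ˢ-∨ˢˡ (swap s) (swap r)))))))))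
        (ℕ.≤-trans (ℕ.≤-reflexive (sym (cross⇒crosses c))) (ℕ.m≤n+m _ (crosses s s))))

  crossingNumber-swap : ∀ s → crossingNumber (swap s) ≡ crossingNumber s
  crossingNumber-swap s = sum-cong-≗ λ i → crosses-⇔ {t = sepAt i} nested-swapʳ nested-swapʳ

  -- `imageˢ α` permutes the set of all pairs of vertex sets, so the sum is merely reindexed.
  crossingNumber-imageˢ : ∀ α s → crossingNumber (imageˢ α s) ≡ crossingNumber s
  crossingNumber-imageˢ α s = trans
    (sum-permute (λ i → crosses (sepAt i) (imageˢ α s))
      (proj₂ finite-Sep ↔-∘ (mk↔ₛ′ (imageˢ α) (imageˢ (flip α)) (imageˢ-flip α) (flip-imageˢ α) ↔-∘ ↔-sym
          (proj₂ finite-Sep))))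
    (sum-cong-≗ λ i → trans (cong (λ t → crosses t (imageˢ α s)) (sepAt-indexOf (imageˢ α (sepAt i))))
      (crosses-⇔
        (λ h → subst (λ t → Nested t s) (flip-imageˢ α (sepAt i))
                 (subst (Nested _) (flip-imageˢ α s) (imageˢ-nested (flip α) h)))
        (imageˢ-nested α)))

  -- Lexicographic in order and crossing number, since every crossing number is at most size.
  weight : Sep n → ℕ
  weight s = order s * suc size + crossingNumber s

  weight≤⇒order≤ : {s r : Sep n} → weight s ≤ weight r → order s ≤ order r
  weight≤⇒order≤ {s} {r} w≤ = ℕ.≮⇒≥ λ r<s → ℕ.<⇒≱ (begin-strict
    weight r ≤⟨ ℕ.+-monoʳ-≤ (order r * suc size) (sum≤size (λ i → crosses≤1 (sepAt i) r)) ⟩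
    order r * suc size + size <⟨ ℕ.+-monoʳ-< (order r * suc size) (ℕ.n<1+n size) ⟩
    order r * suc size + suc size ≡⟨ ℕ.+-comm (order r * suc size) (suc size) ⟩
    suc (order r) * suc size ≤⟨ ℕ.*-monoˡ-≤ (suc size) r<s ⟩
    order s * suc size ≤⟨ ℕ.m≤m+n _ _ ⟩
    weight s ∎) w≤
    where open ℕ.≤-Reasoning

  weight-submodular : {s r : Sep n} → Cross s r →
      weight (s ∨ˢ r) + weight (swap s ∨ˢ swap r) < weight s + weight r
  weight-submodular {s} {r} c = begin-strict
    weight (s ∨ˢ r) + weight (swap s ∨ˢ swap r) ≡⟨ regroup (order (s ∨ˢ r)) (order (swap s ∨ˢ swap r)) _ _ ⟩
    (order (s ∨ˢ r) + order (swap s ∨ˢ swap r)) * suc size +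
        (crossingNumber (s ∨ˢ r) + crossingNumber (swap s ∨ˢ swap r))
      <⟨ ℕ.+-mono-≤-< (ℕ.*-monoˡ-≤ (suc size) (order-submodular s r)) (crossingNumber-submodular c) ⟩
    (order s + order r) * suc size + (crossingNumber s + crossingNumber r) ≡⟨ regroup (order s) (order r) _ _ ⟨
    weight s + weight r ∎
    where
    open ℕ.≤-Reasoning
    regroup : ∀ a b c d → (a * suc size + c) + (b * suc size + d) ≡ (a + b) * suc size + (c + d)
    regroup a b c d = trans (interchange ℕ.+-commutativeSemigroup (a * suc size) c (b * suc size) d)
        (cong (_+ (c + d)) (sym (ℕ.*-distribʳ-+ (suc size) a b)))

  weight-swap : ∀ s → weight (swap s) ≡ weight s
  weight-swap s = cong₂ (λ a b → a * suc size + b) (order-swap s) (crossingNumber-swap s)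

  weight-imageˢ : ∀ α s → weight (imageˢ α s) ≡ weight s
  weight-imageˢ α s = cong₂ (λ a b → a * suc size + b) (order-imageˢ α s) (crossingNumber-imageˢ α s)

-- Paths

module _ {n : ℕ} where
  open DecMembership (Fin._≟_ {n}) using () renaming (_∈?_ to _∈ˡ?_)

  -- The recursive counterpart of `IsPath`. Freshness of each vertex is a premise, so it is at hand
  -- in every induction along a path.
  data Path (R : Rel (Fin n) 0ℓ) : Fin n → List (Fin n) → Fin n → Set where
    [_]  : ∀ x → Path R x (x ∷ []) x
    cons : ∀ {x y p z} → R x y → x ∉ˡ p → Path R y p z → Path R x (x ∷ p) z

  module _ {R : Rel (Fin n) 0ℓ} where

    path⇒isPath : ∀ {x p y} → Path R x p y → IsPath R x p y
    path⇒isPath [ x ] = refl , refl , [-] , [] ∷ []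
    path⇒isPath (cons r x∉ q@([ _ ])) =
      let _ , l , k , u = path⇒isPath q in refl , l , r ∷ k , ¬Any⇒All¬ _ x∉ ∷ u
    path⇒isPath (cons r x∉ q@(cons _ _ _)) =
      let _ , l , k , u = path⇒isPath q in refl , l , r ∷ k , ¬Any⇒All¬ _ x∉ ∷ u

    isPath⇒path : ∀ {x p y} → IsPath R x p y → Path R x p y
    isPath⇒path {p = _ ∷ []} (refl , refl , _ , _) = [ _ ]
    isPath⇒path {p = _ ∷ _ ∷ _} (refl , l , r ∷ k , a ∷ u) =
      cons r (All¬⇒¬Any a) (isPath⇒path (refl , l , k , u))

    path-start : ∀ {x p y} → Path R x p y → x ∈ˡ p
    path-start [ _ ]        = here refl
    path-start (cons _ _ _) = here refl

    path-suffix : ∀ {x p y z} → Path R x p y → z ∈ˡ p → ∃[ q ] Path R z q y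
    path-suffix p@([ _ ])      (here refl) = _ , p
    path-suffix p@(cons _ _ _) (here refl) = _ , p
    path-suffix (cons _ _ p)   (there z∈)  = path-suffix p z∈

    star⇒path : ∀ {x y} → Star R x y → ∃[ p ] Path R x p y
    star⇒path ε = _ , [ _ ]
    star⇒path {x} (r ◅ rs) with star⇒path rs
    ... | p , path with x ∈ˡ? p
    -- The walk returns to `x`; the closed part is cut off.
    ... | yes x∈ = path-suffix path x∈
    ... | no x∉  = _ , cons r x∉ path

    path⇒star : ∀ {x p y} → Path R x p y → Star R x y
    path⇒star [ _ ]        = ε
    path⇒star (cons r _ p) = r ◅ path⇒star p

    -- Grow C, which starts as ⁅ x ⁆, until no edge leaves it.
    component : Binary.Decidable R → ∀ x →
      ∃[ C ] x ∈ C × (∀ {v} → v ∈ C → Star R x v) × (∀ {u v} → u ∈ C → R u v → v ∈ C)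
    component R? x = grow ⁅ x ⁆ (⊃-wellFounded _) (x∈⁅x⁆ x) λ v∈ → subst (Star R x) (sym (x∈⁅y⁆⇒x≡y x v∈)) ε
      where
      grow : ∀ C → Acc _⊃_ C → x ∈ C → (∀ {v} → v ∈ C → Star R x v) →
        ∃[ C ] x ∈ C × (∀ {v} → v ∈ C → Star R x v) × (∀ {u v} → u ∈ C → R u v → v ∈ C)
      grow C (acc rec) x∈ reach
        with Fin.any? (λ u → Fin.any? λ v → u ∈? C ×-dec (R? u v ×-dec ¬? (v ∈? C)))
      ... | no closed = C , x∈ , reach ,
        λ {u} {v} u∈ r → decidable-stable (v ∈? C) λ v∉ → closed (u , v , u∈ , r , v∉)
      ... | yes (u , v , u∈ , r , v∉) =
        grow (C ∪ ⁅ v ⁆) (rec (p⊆p∪q _ , v , x∈p∪q⁺ (inj₂ (x∈⁅x⁆ v)) , v∉)) (p⊆p∪q _ x∈) λ {w} w∈ →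
          Sum.[ reach , (λ w∈v → subst (Star R x) (sym (x∈⁅y⁆⇒x≡y v w∈v)) (reach u∈ ◅◅ (r ◅ ε))) ]
              (x∈p∪q⁻ C ⁅ v ⁆ w∈)

    closed-star : ∀ {P : Fin n → Set} → (∀ {u v} → P u → R u v → P v) → ∀ {x y} → Star R x y → P x → P y
    closed-star c ε        px = px
    closed-star c (r ◅ rs) px = closed-star c rs (c px r)

    star? : Binary.Decidable R → ∀ x y → Dec (Star R x y)
    star? R? x y with component R? x
    ... | C , x∈ , reach , closed = map′ reach (λ rs → closed-star closed rs x∈) (y ∈? C)

  path-map : ∀ {R R′ : Rel (Fin n) 0ℓ} {x p y} →
    (∀ {u v} → u ∈ˡ p → v ∈ˡ p → R u v → R′ u v) → Path R x p y → Path R′ x p y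
  path-map f [ x ]         = [ x ]
  path-map f (cons r x∉ p) = cons (f (here refl) (there (path-start p)) r) x∉
    (path-map (λ u∈ v∈ → f (there u∈) (there v∈)) p)

⊈⇒∃ : {X Y : Subset n} → ¬ X ⊆ Y → ∃[ x ] x ∈ X × x ∉ Y
⊈⇒∃ {X = X} {Y} X⊈Y with Fin.any? (λ x → x ∈? X ×-dec ¬? (x ∈? Y))
... | yes h = h
... | no ∄  = ⊥-elim (X⊈Y λ {x} x∈ → decidable-stable (x ∈? Y) λ x∉ → ∄ (x , x∈ , x∉))

-- Blocks

module _ {n} (G : Graph n) where

  -- No edge leads from outside `B` to outside `A`, so the path stays outside `B` until it meets a
  -- vertex of `A ∩ B`.
  isSeparation⇒separates : ∀ {s x y} → IsSeparation G s → x ∉ proj₂ s → y ∉ proj₁ s →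
    Separates G (proj₁ s ∩ proj₂ s) x y
  isSeparation⇒separates {A , B} sep x∉ y∉ =
    x∉ ∘ proj₂ ∘ x∈p∩q⁻ A B , y∉ ∘ proj₁ ∘ x∈p∩q⁻ A B , λ p path → hit x∉ y∉ (isPath⇒path path)
    where
    hit : ∀ {x p y} → x ∉ B → y ∉ A → Path (Adj G) x p y → Any (_∈ A ∩ B) p
    hit x∉ y∉ [ _ ] = contradiction (∉proj₂⇒∈proj₁ G sep x∉) y∉
    hit x∉ y∉ (cons {y = x′} e _ p) with x′ ∈? B | x′ ∈? A
    ... | no x′∉B | _        = there (hit x′∉B y∉ p)
    ... | _       | no x′∉A  = contradiction e (no-edge G sep x∉ x′∉A)
    ... | yes b   | yes a    = there (Any.map (λ { refl → x∈p∩q⁺ (a , b) }) (path-start p))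

  -- The component of x in G - W gives the separation.
  separates⇒isSeparation : ∀ {W x y} → Separates G W x y →
    ∃[ s ] IsSeparation G s × order s ≤ ∣ W ∣ × x ∉ proj₂ s × y ∉ proj₁ s
  separates⇒isSeparation {W} {x} {y} (x∉W , y∉W , hits)
    with component {R = λ u v → Adj G u v × u ∉ W × v ∉ W} (λ u v → Graph.adj? G u v ×-dec (¬? (u ∈? W) ×-dec ¬? (v ∈? W))) x
  ... | C , x∈C , reach , closed = (C ∪ W , ∁ C) , isSeparation⁺ G cov edge ,
      p⊆q⇒∣p∣≤∣q∣ (λ h → inW (x∈p∩q⁻ (C ∪ W) (∁ C) h)) , (λ h → x∈∁p⇒x∉p h x∈C) ,
      λ h → Sum.[ y∉C , y∉W ] (x∈p∪q⁻ C W h)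
    where
    cov : ∀ v → v ∈ C ∪ W ⊎ v ∈ ∁ C
    cov v with v ∈? C
    ... | yes v∈ = inj₁ (p⊆p∪q W v∈)
    ... | no v∉  = inj₂ (x∉p⇒x∈∁p v∉)

    disjoint : ∀ {v} → v ∈ C → v ∉ W
    disjoint v∈C = closed-star {P = _∉ W} (λ _ (_ , _ , v∉) → v∉) (reach v∈C) x∉W

    edge : ∀ {u v} → u ∉ ∁ C → v ∉ C ∪ W → ¬ Adj G u v
    edge {u} {v} u∉ v∉ e = v∉ (p⊆p∪q W (closed u∈ (e , disjoint u∈ , v∉ ∘ q⊆p∪q C W)))
      where u∈ = x∉∁p⇒x∈p u∉

    inW : ∀ {v} → v ∈ C ∪ W × v ∈ ∁ C → v ∈ W
    inW (a , b) with x∈p∪q⁻ C W a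
    ... | inj₁ v∈C = contradiction v∈C (x∈∁p⇒x∉p b)
    ... | inj₂ v∈W = v∈W

    y∉C : y ∉ C
    y∉C y∈C with star⇒path (reach y∈C)
    ... | p , path = avoid path (hits p (path⇒isPath (path-map (λ _ _ → proj₁) path)))
      where
      avoid : ∀ {u p} → Path (λ u v → Adj G u v × u ∉ W × v ∉ W) u p y → ¬ Any (_∈ W) p
      avoid [ _ ]                  (here v∈)  = y∉W v∈
      avoid (cons (_ , u∉ , _) _ _) (here u∈) = u∉ u∈
      avoid (cons _ _ p)           (there h)  = avoid p h

  -- Inseparability in terms of separations instead of separators and paths. This form is decided by
  -- finite search and places a block on a side of every separation of order below `k`.
  Unsplit : ℕ → Subset n → Set
  Unsplit k X = ∀ s → IsSeparation G s × order s < k → X ⊆ proj₁ s ⊎ X ⊆ proj₂ s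

  inseparable⇒unsplit : ∀ {k X} → Inseparable G k X → Unsplit k X
  inseparable⇒unsplit {X = X} insep (A , B) (sep , o) with X ⊆? A | X ⊆? B
  ... | yes a | _     = inj₁ a
  ... | _     | yes b = inj₂ b
  ... | no ¬a | no ¬b with ⊈⇒∃ ¬a | ⊈⇒∃ ¬b
  ... | y , y∈ , y∉A | x , x∈ , x∉B =
        ⊥-elim (insep x y x∈ y∈ x≢y (A ∩ B , o , isSeparation⇒separates sep x∉B y∉A))
    where
    x≢y : x ≢ y
    x≢y refl = y∉A (∉proj₂⇒∈proj₁ G sep x∉B)

  unsplit⇒inseparable : ∀ {k X} → Unsplit k X → Inseparable G k X
  unsplit⇒inseparable unsplit x y x∈ y∈ _ (W , o , seps) with separates⇒isSeparation seps
  ... | s , sep , o≤ , x∉B , y∉A with unsplit s (sep , ℕ.≤-<-trans o≤ o)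
  ... | inj₁ X⊆A = y∉A (X⊆A y∈)
  ... | inj₂ X⊆B = x∉B (X⊆B x∈)

  inseparable? : ∀ k → Decidable (Inseparable G k)
  inseparable? k X = map′ unsplit⇒inseparable inseparable⇒unsplit
    (all? finite-Sep λ s → (isSeparation? G s ×-dec order s ℕ.<? k) →-dec (X ⊆? proj₁ s ⊎-dec X ⊆? proj₂ s))

  isBlock? : ∀ k → Decidable (IsBlock G k)
  isBlock? k X = large? X ×-dec all? (finite-Subset n) (λ Y → large? Y →-dec (X ⊆? Y →-dec (Y ≟ᵛ X)))
    where
    large? = λ Y → k ℕ.≤? ∣ Y ∣ ×-dec inseparable? k Y

  module _ {k X} (block : IsBlock G k X) where

    block-unsplit : ∀ {s} → IsSeparation G s → order s < k → X ⊆ proj₁ s ⊎ X ⊆ proj₂ s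
    block-unsplit sep o = inseparable⇒unsplit (proj₂ (proj₁ block)) _ (sep , o)

    -- Otherwise `X`, with its at least `k` vertices, would have to fit into the separator.
    block-one-side : ∀ {s} → order s < k → X ⊆ proj₁ s → ¬ X ⊆ proj₂ s
    block-one-side o a b = ℕ.<⇒≱ o (ℕ.≤-trans (proj₁ (proj₁ block)) (p⊆q⇒∣p∣≤∣q∣ λ x∈ → x∈p∩q⁺ (a x∈ , b x∈)))

    block-unsplitʳ : ∀ {s} → IsSeparation G s → order s < k → ¬ X ⊆ proj₁ s → X ⊆ proj₂ s
    block-unsplitʳ {s} sep o X⊈A with block-unsplit {s} sep o
    ... | inj₁ X⊆A = ⊥-elim (X⊈A X⊆A)
    ... | inj₂ X⊆B = X⊆B

    block-unsplitˡ : ∀ {s} → IsSeparation G s → order s < k → ¬ X ⊆ proj₂ s → X ⊆ proj₁ s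
    block-unsplitˡ {s} sep o X⊈B with block-unsplit {s} sep o
    ... | inj₁ X⊆A = X⊆A
    ... | inj₂ X⊆B = ⊥-elim (X⊈B X⊆B)

  -- After the removal `w` lies on the right only, so the sole edges that could do harm join it to
  -- `A ─ B`.
  remove-isSeparation : ∀ {A B w} → IsSeparation G (A , B) → w ∈ A ∩ B →
    ¬ (∃[ a ] a ∈ A ─ B × Adj G w a) → IsSeparation G (A - w , B) × order (A - w , B) < order (A , B)
  remove-isSeparation {A} {B} {w} sep w∈ isolated = isSeparation⁺ G cov edge , p⊂q⇒∣p∣<∣q∣ smaller
    where
    w∈B = proj₂ (x∈p∩q⁻ A B w∈)
    cov : ∀ v → v ∈ A - w ⊎ v ∈ B
    cov v with cover G sep v | v Fin.≟ w
    ... | inj₂ b | _ = inj₂ b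
    ... | inj₁ _ | yes refl = inj₂ w∈B
    ... | inj₁ a | no v≢w = inj₁ (x∈p∧x≢y⇒x∈p-y a v≢w)
    edge : ∀ {u v} → u ∉ B → v ∉ A - w → ¬ Adj G u v
    edge {u} {v} u∉ v∉ e with v Fin.≟ w
    ... | yes refl = isolated (u , x∈p∧x∉q⇒x∈p─q (∉proj₂⇒∈proj₁ G sep u∉) u∉ , Graph.sym G e)
    ... | no v≢w   = no-edge G sep u∉ (λ v∈A → v∉ (x∈p∧x≢y⇒x∈p-y v∈A v≢w)) e
    smaller : (A - w) ∩ B ⊂ A ∩ B
    smaller = (λ h → let a , b = x∈p∩q⁻ (A - w) B h in x∈p∩q⁺ (p─q⊆p A ⁅ w ⁆ a , b)) ,
      w , w∈ , λ h → x∈p─q⇒x∉q A ⁅ w ⁆ (proj₁ (x∈p∩q⁻ (A - w) B h)) (x∈⁅x⁆ w)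

  -- A vertex of A ∩ B without neighbours in A ─ B could be removed from A, and symmetrically.
  minimal⇒tight : (Q : Pred (Sep n) 0ℓ) {s : Sep n} → IsSeparation G s →
    (∀ r → IsSeparation G r → Q r → order s ≤ order r) →
    (∀ w {r} → r ≡ (proj₁ s - w , proj₂ s) → w ∈ proj₁ s ∩ proj₂ s → IsSeparation G r →
        order r < order s → Q r) →
    (∀ w {r} → r ≡ (proj₁ s , proj₂ s - w) → w ∈ proj₁ s ∩ proj₂ s → IsSeparation G r →
        order r < order s → Q r) →
    Tight G s
  minimal⇒tight Q {A , B} sep minimal Qˡ Qʳ w w∈ = left , right
    where
    left : ∃[ a ] a ∈ A ─ B × Adj G w a
    left with Fin.any? (λ a → a ∈? (A ─ B) ×-dec Graph.adj? G w a)
    ... | yes h = h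
    ... | no isolated =
      let sep′ , o< = remove-isSeparation sep w∈ isolated
      in contradiction (minimal _ sep′ (Qˡ w refl w∈ sep′ o<)) (ℕ.<⇒≱ o<)
    right : ∃[ b ] b ∈ B ─ A × Adj G w b
    right with Fin.any? (λ b → b ∈? (B ─ A) ×-dec Graph.adj? G w b)
    ... | yes h = h
    ... | no isolated =
      let sep′ , o<′ = remove-isSeparation (isSeparation-swap G sep) (subst (w ∈_) (∩-comm A B) w∈) isolated
          sep″ = isSeparation-swap G sep′
          o< = ℕ.≤-trans (ℕ.≤-reflexive (cong suc (order-swap (B - w , A))))
              (ℕ.≤-trans o<′ (ℕ.≤-reflexive (order-swap (A , B))))
      in contradiction (minimal _ sep″ (Qʳ w refl w∈ sep″ o<)) (ℕ.<⇒≱ o<)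

  module _ {k X} (block : IsBlock G k X) where

    -- Among the separations of order below `k` that have `X` on the right and leave `v` out of that
    -- side, one of least order is tight. Tightness is what later places it in `S`.
    separate-vertex : ∀ {v} → v ∉ X →
      ∃[ s ] (IsSeparation G s × Tight G s × Proper s × order s < k) × X ⊆ proj₂ s × v ∉ proj₂ s
    separate-vertex {v} v∉X = go (argmin finite-Sep Q? order some)
      where
      Q : Pred (Sep n) 0ℓ
      Q s = IsSeparation G s × order s < k × X ⊆ proj₂ s × v ∉ proj₂ s

      Q? : Decidable Q
      Q? s = isSeparation? G s ×-dec (order s ℕ.<? k ×-dec (X ⊆? proj₂ s ×-dec ¬? (v ∈? proj₂ s)))

      -- Otherwise X ∪ ⁅ v ⁆ would be inseparable.
      some : ∃ Q
      some with any? finite-Sep Q?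
      ... | yes q = q
      ... | no ∄  = ⊥-elim (v∉X (subst (v ∈_)
        (proj₂ block (X ∪ ⁅ v ⁆) (large , unsplit⇒inseparable unsplit) (p⊆p∪q ⁅ v ⁆))
            (q⊆p∪q X ⁅ v ⁆ (x∈⁅x⁆ v))))
        where
        large = ℕ.≤-trans (proj₁ (proj₁ block)) (∣p∣≤∣p∪q∣ X ⁅ v ⁆)
        add : ∀ {C} → X ⊆ C → v ∈ C → X ∪ ⁅ v ⁆ ⊆ C
        add {C} X⊆C v∈C h = Sum.[ X⊆C , (λ u∈v → subst (_∈ C) (sym (x∈⁅y⁆⇒x≡y v u∈v)) v∈C) ] (x∈p∪q⁻ X ⁅ v ⁆ h)
        unsplit : Unsplit k (X ∪ ⁅ v ⁆)
        unsplit s (sep , o) with block-unsplit block sep o | v ∈? proj₁ s | v ∈? proj₂ s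
        ... | inj₁ X⊆A | yes v∈A | _       = inj₁ (add X⊆A v∈A)
        ... | inj₂ X⊆B | _       | yes v∈B = inj₂ (add X⊆B v∈B)
        ... | inj₂ X⊆B | _       | no v∉B  = ⊥-elim (∄ (s , sep , o , X⊆B , v∉B))
        ... | inj₁ X⊆A | no v∉A  | _       = ⊥-elim (∄
          (swap s , isSeparation-swap G sep , ℕ.≤-<-trans (ℕ.≤-reflexive (order-swap s)) o , X⊆A , v∉A))

      go : (∃[ s ] Q s × (∀ r → Q r → order s ≤ order r)) →
        ∃[ s ] (IsSeparation G s × Tight G s × Proper s × order s < k) × X ⊆ proj₂ s × v ∉ proj₂ s
      go (s@(A , B) , (sep , o , X⊆B , v∉B) , minimal) = s , (sep , tight , proper , o) , X⊆B , v∉B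
        where
        proper : Proper s
        proper = (λ A⊆B → v∉B (A⊆B (∉proj₂⇒∈proj₁ G sep v∉B))) , λ B⊆A → block-one-side block o (B⊆A ∘ X⊆B) X⊆B
        tight : Tight G s
        tight = minimal⇒tight (λ r → order r < k × X ⊆ proj₂ r × v ∉ proj₂ r) sep (λ r a b → minimal r (a , b))
          (λ { w refl w∈ sep′ o′ → ℕ.<-trans o′ o , X⊆B , v∉B })
          -- The vertex `w` taken from `B` might belong to `X`. Still `X` is on one side of the new
          -- separation, and that side is not `A`, because `X` already lies in `B`.
          λ { w refl w∈ sep′ o′ → ℕ.<-trans o′ o ,
              block-unsplitʳ block sep′ (ℕ.<-trans o′ o) (λ X⊆A → block-one-side block {s} o X⊆A X⊆B) ,
              v∉B ∘ p─q⊆p B ⁅ w ⁆ }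

  -- Optimal distinguishers of two blocks

  Distinguishes : Subset n → Subset n → Pred (Sep n) 0ℓ
  Distinguishes X Y s = IsSeparation G s × X ⊆ proj₁ s × Y ⊆ proj₂ s

  Optimal : Subset n → Subset n → Pred (Sep n) 0ℓ
  Optimal X Y s = Distinguishes X Y s × (∀ r → Distinguishes X Y r → weight s ≤ weight r)

  distinguishes? : ∀ X Y → Decidable (Distinguishes X Y)
  distinguishes? X Y s = isSeparation? G s ×-dec (X ⊆? proj₁ s ×-dec Y ⊆? proj₂ s)

  optimal? : ∀ X Y → Decidable (Optimal X Y)
  optimal? X Y s = distinguishes? X Y s ×-dec all? finite-Sep λ r →
      distinguishes? X Y r →-dec weight s ℕ.≤? weight r

  distinguishes-swap : ∀ {X Y s} → Distinguishes X Y s → Distinguishes Y X (swap s)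
  distinguishes-swap (sep , a , b) = isSeparation-swap G sep , b , a

  optimal-swap : ∀ {X Y s} → Optimal X Y s → Optimal Y X (swap s)
  optimal-swap {s = s} (d , minimal) = distinguishes-swap d , λ r d′ →
    ℕ.≤-trans (ℕ.≤-reflexive (weight-swap s))
      (ℕ.≤-trans (minimal (swap r) (distinguishes-swap d′)) (ℕ.≤-reflexive (weight-swap r)))

  -- By maximality of `X` some vertex of `X` lies outside `Y`. A separation cutting it off from `Y`
  -- has the whole of the unsplit block `X` on the left.
  distinguisher : ∀ {k X Y} → IsBlock G k X → IsBlock G k Y → X ≢ Y →
    ∃[ s ] Distinguishes X Y s × order s < k
  distinguisher {k} {X} {Y} bX bY X≢Y with X ⊆? Y
  ... | yes X⊆Y = contradiction (sym (proj₂ bX Y (proj₁ bY) X⊆Y)) X≢Y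
  ... | no X⊈Y = let v , v∈X , v∉Y = ⊈⇒∃ X⊈Y
                     s , (sep , _ , _ , o) , Y⊆B , v∉B = separate-vertex bY v∉Y
                 in s , (sep , block-unsplitˡ bX sep o (λ X⊆B → v∉B (X⊆B v∈X)) , Y⊆B) , o

  optimal-exists : ∀ {k X Y} → IsBlock G k X → IsBlock G k Y → X ≢ Y → ∃ (Optimal X Y)
  optimal-exists bX bY X≢Y = argmin finite-Sep (distinguishes? _ _) weight
    (let s , d , _ = distinguisher bX bY X≢Y in s , d)

  module _ {k X Y} (bX : IsBlock G k X) (bY : IsBlock G k Y) (X≢Y : X ≢ Y) {s} (opt : Optimal X Y s) where

    -- Order takes precedence in `weight`, so no distinguisher has smaller order than an optimal
    -- one, and `distinguisher` supplies one of order below `k`.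
    optimal-order : order s < k
    optimal-order = let r , d , o = distinguisher bX bY X≢Y in
      ℕ.≤-<-trans (weight≤⇒order≤ {s = s} {r} (proj₂ opt r d)) o

    optimal-tight : Tight G s
    optimal-tight = let (sep , X⊆A , Y⊆B) , minimal = opt in
      minimal⇒tight (λ r → X ⊆ proj₁ r × Y ⊆ proj₂ r) sep
        (λ r sep′ (a , b) → weight≤⇒order≤ {s = s} {r} (minimal r (sep′ , a , b)))
        (λ { w refl w∈ sep′ o′ →
             block-unsplitˡ bX sep′ (ℕ.<-trans o′ optimal-order)
                 (λ X⊆B → block-one-side bX {s} optimal-order X⊆A X⊆B) , Y⊆B })
        λ { w refl w∈ sep′ o′ → X⊆A ,
             block-unsplitʳ bY sep′ (ℕ.<-trans o′ optimal-order)
                 (λ Y⊆A → block-one-side bY {s} optimal-order Y⊆A Y⊆B) }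

    optimal-proper : Proper s
    optimal-proper = let (_ , X⊆A , Y⊆B) , _ = opt in
      (λ A⊆B → block-one-side bX {s = s} optimal-order X⊆A (A⊆B ∘ X⊆A)) ,
      (λ B⊆A → block-one-side bY {s = s} optimal-order (B⊆A ∘ Y⊆B) Y⊆B)

  -- Both opposite corners also distinguish `X` from `Y`, so each weighs at least as much as `s`,
  -- while together they weigh less than `s` and `r`.
  optimal-weight<ʳ : ∀ {X Y s r} → Optimal X Y s → Cross s r → Distinguishes X Y r → weight s < weight r
  optimal-weight<ʳ {X} {Y} {s@(A , B)} {r@(C , D)} ((sep , X⊆A , Y⊆B) , minimal) cross (sep′ , X⊆C , Y⊆D) =
    ℕ.+-cancelˡ-< (weight s) (weight s) (weight r)
      (ℕ.≤-<-trans (ℕ.+-mono-≤ corner₁ corner₂) (weight-submodular {s = s} {r} cross))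
    where
    corner₁ : weight s ≤ weight (s ∨ˢ r)
    corner₁ = minimal (s ∨ˢ r) (∨ˢ-isSeparation G sep sep′ , p⊆p∪q C ∘ X⊆A , λ y∈ → x∈p∩q⁺ (Y⊆B y∈ , Y⊆D y∈))
    corner₂ : weight s ≤ weight (swap s ∨ˢ swap r)
    corner₂ = ℕ.≤-trans
      (minimal (swap (swap s ∨ˢ swap r))
        (isSeparation-swap G (∨ˢ-isSeparation G (isSeparation-swap G sep) (isSeparation-swap G sep′)) ,
         (λ x∈ → x∈p∩q⁺ (X⊆A x∈ , X⊆C x∈)) , p⊆p∪q D ∘ Y⊆B))
      (ℕ.≤-reflexive (weight-swap (swap s ∨ˢ swap r)))

  -- One corner distinguishes `X` from `Y`, the opposite one `Z` from `W`. By optimality they weigh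
  -- at least as much as `s` and `r` together, against strict submodularity.
  optimal-nested-same-side : ∀ {X Y Z W s r} → Optimal X Y s → Optimal Z W r → Z ⊆ proj₁ s → Y ⊆ proj₂ r →
      ¬ Cross s r
  optimal-nested-same-side {s = s@(A , B)} {r@(C , D)} ((sep , X⊆A , Y⊆B) , minimal)
      ((sep′ , Z⊆C , W⊆D) , minimal′) Z⊆A Y⊆D cross =
    ℕ.<⇒≱ (weight-submodular {s = s} {r} cross) (ℕ.+-mono-≤ corner₁ corner₂)
    where
    corner₁ : weight s ≤ weight (s ∨ˢ r)
    corner₁ = minimal (s ∨ˢ r) (∨ˢ-isSeparation G sep sep′ , p⊆p∪q C ∘ X⊆A , λ y∈ → x∈p∩q⁺ (Y⊆B y∈ , Y⊆D y∈))
    corner₂ : weight r ≤ weight (swap s ∨ˢ swap r)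
    corner₂ = ℕ.≤-trans
      (minimal′ (swap (swap s ∨ˢ swap r))
        (isSeparation-swap G (∨ˢ-isSeparation G (isSeparation-swap G sep) (isSeparation-swap G sep′)) ,
         (λ z∈ → x∈p∩q⁺ (Z⊆A z∈ , Z⊆C z∈)) , q⊆p∪q B D ∘ W⊆D))
      (ℕ.≤-reflexive (weight-swap (swap s ∨ˢ swap r)))

  module _ {k X Y Z W} (bX : IsBlock G k X) (bY : IsBlock G k Y) (X≢Y : X ≢ Y)
           (bZ : IsBlock G k Z) (bW : IsBlock G k W) (Z≢W : Z ≢ W) where

    -- If `r` has `X` and `Y` on different sides, it is a distinguisher for them not heavier than
    -- `s`, against `optimal-weight<ʳ`. If they are on the same side, take whichever of `Z` and `W`
    -- is on the other side of `r`: its position relative to `s` tells which opposite corners to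
    -- compare.
    optimal-nested-≤ : ∀ {s r} → Optimal X Y s → Optimal Z W r → weight r ≤ weight s → Nested s r
    optimal-nested-≤ {s} {r} os or r≤s = decidable-stable (nested? s r) λ cross →
      let sep-s = proj₁ (proj₁ os); sep-r = proj₁ (proj₁ or)
          o-s = optimal-order bX bY X≢Y os; o-r = optimal-order bZ bW Z≢W or
          crossʳ = λ h → cross (nested-swapʳ {s = s} {swap r} h)
          crossˡ = λ h → cross (nested-swapˡ {s = swap s} {r} h)
          crossˡʳ = cross-swap {s = s} {r} cross
      in case block-unsplit bX sep-r o-r , block-unsplit bY sep-r o-r of λ where
        (inj₁ X⊆C , inj₂ Y⊆D) → ℕ.<⇒≱ (optimal-weight<ʳ os cross (sep-r , X⊆C , Y⊆D)) r≤s
        (inj₂ X⊆D , inj₁ Y⊆C) → ℕ.<⇒≱ (optimal-weight<ʳ os crossʳ (isSeparation-swap G sep-r , X⊆D , Y⊆C))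
                                   (ℕ.≤-trans (ℕ.≤-reflexive (weight-swap r)) r≤s)
        (inj₂ X⊆D , inj₂ Y⊆D) → case block-unsplit bZ sep-s o-s of λ where
          (inj₁ Z⊆A) → optimal-nested-same-side os or Z⊆A Y⊆D cross
          (inj₂ Z⊆B) → optimal-nested-same-side (optimal-swap os) or Z⊆B X⊆D crossˡ
        (inj₁ X⊆C , inj₁ Y⊆C) → case block-unsplit bW sep-s o-s of λ where
          (inj₁ W⊆A) → optimal-nested-same-side os (optimal-swap or) W⊆A Y⊆C crossʳ
          (inj₂ W⊆B) → optimal-nested-same-side (optimal-swap os) (optimal-swap or) W⊆B X⊆C crossˡʳ

  module _ (k : ℕ) where

    OptimalDistinguisher : Pred (Sep n) 0ℓ
    OptimalDistinguisher s = ∃₂ λ X Y → IsBlock G k X × IsBlock G k Y × X ≢ Y × Optimal X Y s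

    optimalDistinguisher? : Decidable OptimalDistinguisher
    optimalDistinguisher? s = any? (finite-Subset n) λ X → any? (finite-Subset n) λ Y →
      isBlock? k X ×-dec (isBlock? k Y ×-dec (¬? (X ≟ᵛ Y) ×-dec optimal? X Y s))

    optimalDistinguisher-nested : ∀ {s r} → OptimalDistinguisher s → OptimalDistinguisher r → Nested s r
    optimalDistinguisher-nested {s} {r} (_ , _ , bX , bY , X≢Y , os) (_ , _ , bZ , bW , Z≢W , or)
      with ℕ.≤-total (weight r) (weight s)
    ... | inj₁ r≤s = optimal-nested-≤ bX bY X≢Y bZ bW Z≢W os or r≤s
    ... | inj₂ s≤r = nested-sym (optimal-nested-≤ bZ bW Z≢W bX bY X≢Y or os s≤r)

  -- Invariance of blocks and optimal distinguishers under automorphisms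

  module _ (α : Permutation′ n) (auto : IsAutomorphism G α) where

    image-inseparable : ∀ {k X} → Inseparable G k X → Inseparable G k (image α X)
    image-inseparable {k} {X} insep = unsplit⇒inseparable λ s (sep , o) →
      Sum.map (⊆image-flip⁻ α {X} {proj₁ s}) (⊆image-flip⁻ α {X} {proj₂ s})
        (inseparable⇒unsplit insep (imageˢ (flip α) s)
          (imageˢ-isSeparation G (flip α) (flip-isAutomorphism G α auto) sep ,
           ℕ.≤-<-trans (ℕ.≤-reflexive (order-imageˢ (flip α) s)) o))

    distinguishes-imageˢ : ∀ {X Y s} → Distinguishes X Y s → Distinguishes (image α X) (image α Y) (imageˢ α s)
    distinguishes-imageˢ (sep , a , b) = imageˢ-isSeparation G α auto sep , image-mono α a , image-mono α b

  module _ (α : Permutation′ n) (auto : IsAutomorphism G α) where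

    image-isBlock : ∀ {k X} → IsBlock G k X → IsBlock G k (image α X)
    image-isBlock {k} {X} ((large , insep) , maximal) =
      (ℕ.≤-trans large (ℕ.≤-reflexive (sym (∣image∣ α X))) , image-inseparable α auto insep) ,
      λ Y (large′ , insep′) αX⊆Y → trans (sym (image-flip α Y)) (cong (image α)
        (maximal (image (flip α) Y)
          (ℕ.≤-trans large′ (ℕ.≤-reflexive (sym (∣image∣ (flip α) Y))) ,
           image-inseparable (flip α) (flip-isAutomorphism G α auto) insep′)
          (⊆image-flip⁺ α αX⊆Y)))

    optimalDistinguisher-imageˢ : ∀ k {s} → OptimalDistinguisher k s → OptimalDistinguisher k (imageˢ α s)
    optimalDistinguisher-imageˢ k {s} (X , Y , bX , bY , X≢Y , d , minimal) =
      image α X , image α Y , image-isBlock bX , image-isBlock bY ,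
      (λ e → X≢Y (trans (sym (flip-image α X)) (trans (cong (image (flip α)) e) (flip-image α Y)))) ,
      distinguishes-imageˢ α auto {X} {Y} {s} d , λ r d′ →
        ℕ.≤-trans (ℕ.≤-reflexive (weight-imageˢ α s)) (ℕ.≤-trans
          (minimal (imageˢ (flip α) r)
            (subst (λ Z → Distinguishes Z Y (imageˢ (flip α) r)) (flip-image α X)
              (subst (λ Z → Distinguishes (image (flip α) (image α X)) Z (imageˢ (flip α) r)) (flip-image α Y)
                (distinguishes-imageˢ (flip α) (flip-isAutomorphism G α auto) {s = r} d′))))
          (ℕ.≤-reflexive (weight-imageˢ (flip α) r)))

-- A strict step upwards enlarges `A` or shrinks `B`, so a minimiser of the sum of the sizes of
-- `∁ A` and `B` is maximal.
maximal-above : ∀ {n} {Q : Pred (Sep n) 0ℓ} → Decidable Q → ∀ {s} → Q s →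
  ∃[ t ] Q t × s ≤ˢ t × (∀ r → Q r → t ≤ˢ r → r ≡ t)
maximal-above {Q = Q} Q? {s} q =
    go (argmin finite-Sep (λ t → Q? t ×-dec s ≤ˢ? t) (λ (A , B) → ∣ ∁ A ∣ ℕ.+ ∣ B ∣) (s , q , ≤ˢ-refl s))
  where
  go : (∃ λ t → (Q t × s ≤ˢ t) × (∀ r → Q r × s ≤ˢ r →
      ∣ ∁ (proj₁ t) ∣ ℕ.+ ∣ proj₂ t ∣ ≤ ∣ ∁ (proj₁ r) ∣ ℕ.+ ∣ proj₂ r ∣)) →
       ∃[ t ] Q t × s ≤ˢ t × (∀ r → Q r → t ≤ˢ r → r ≡ t)
  go (t@(A , B) , (qt , s≤t) , minimal) = t , qt , s≤t , λ where
    r@(C , D) qr t≤r@(A⊆C , D⊆B) → ≤ˢ-antisym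
      ((λ {x} x∈C → decidable-stable (x ∈? A) λ x∉A → ℕ.<⇒≱
          (ℕ.+-mono-<-≤ (p⊂q⇒∣p∣<∣q∣ (p⊂q⇒∁p⊃∁q ((λ {y} → A⊆C {y}) , x , x∈C , x∉A))) (p⊆q⇒∣p∣≤∣q∣ D⊆B))
          (minimal r (qr , ≤ˢ-trans {s = s} {t} {r} s≤t t≤r))) ,
       (λ {x} x∈B → decidable-stable (x ∈? D) λ x∉D → ℕ.<⇒≱
          (ℕ.+-mono-≤-< (p⊆q⇒∣p∣≤∣q∣ (p⊆q⇒∁p⊇∁q A⊆C)) (p⊂q⇒∣p∣<∣q∣ ((λ {y} → D⊆B {y}) , x , x∈B , x∉D)))
          (minimal r (qr , ≤ˢ-trans {s = s} {t} {r} s≤t t≤r))))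
      t≤r

-- Orientations of a set of separations

module _ {n} (N : Pred (Sep n) 0ℓ) where

  -- Containing `(A , B)` means pointing to `B`. The field `downward` is the usual consistency: no
  -- two chosen separations point away from each other.
  record IsOrientation (O : Pred (Sep n) 0ℓ) : Set where
    field
      within     : ∀ {s} → O s → N s
      total      : ∀ {s} → N s → O s ⊎ O (swap s)
      consistent : ∀ {s} → O s → ¬ O (swap s)
      downward   : ∀ {r s} → N r → r ≤ˢ s → O s → O r

  isOrientation? : Decidable N → ∀ {O} → Decidable O → Dec (IsOrientation O)
  isOrientation? N? O? = map′
    (λ (w , t , c , d) → record
      { within = w _ ; total = t _ ; consistent = c _ ; downward = d _ _ })
    (λ o → let open IsOrientation o in
      (λ _ → within) , (λ _ → total) , (λ _ → consistent) , λ _ _ → downward)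
    (all? finite-Sep (λ s → O? s →-dec N? s)
      ×-dec all? finite-Sep (λ s → N? s →-dec (O? s ⊎-dec O? (swap s)))
      ×-dec all? finite-Sep (λ s → O? s →-dec ¬? (O? (swap s)))
      ×-dec all? finite-Sep (λ r → all? finite-Sep λ s → N? r →-dec (r ≤ˢ? s →-dec (O? s →-dec O? r))))

  -- One inclusion suffices in `∋-injective`: for each `s` in `N` an orientation contains exactly
  -- one of `s` and `swap s`, so none is properly contained in another.
  record Orientations : Set₁ where
    field
      {m}           : ℕ
      _∋_           : Fin m → Pred (Sep n) 0ℓ
      _∋?_          : ∀ i → Decidable (i ∋_)
      isOrientation : ∀ i → IsOrientation (i ∋_)
      ∋-injective   : ∀ {i j} → (∀ {s} → i ∋ s → j ∋ s) → i ≡ j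
      index         : ∀ {O} → Decidable O → IsOrientation O → ∃[ i ] (∀ s → i ∋ s ⇔ O s)

  abstract
    orientations : Decidable N → Orientations
    orientations N? = go (enumerate (finite-Subset _) {P = λ O → IsOrientation λ s → indexOf s ∈ O}
      λ O → isOrientation? N? λ s → indexOf s ∈? O)
      where
      open Inverse (proj₂ (finite-Sep {n})) renaming
          (to to indexOf; from to sepAt; strictlyInverseˡ to indexOf-sepAt; strictlyInverseʳ to sepAt-indexOf)
      go : (∃₂ λ m (g : Fin m → Subset _) → (∀ {i j} → g i ≡ g j → i ≡ j) ×
             (∀ i → IsOrientation λ s → indexOf s ∈ g i) ×
             (∀ O → (IsOrientation λ s → indexOf s ∈ O) → ∃ λ i → g i ≡ O)) → Orientations
      go (m , g , injective , sound , complete) = record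
        { _∋_ = λ i s → indexOf s ∈ g i
        ; _∋?_ = λ i s → indexOf s ∈? g i
        ; isOrientation = sound
        ; ∋-injective = λ {i} {j} h →
            injective (⊆-antisym (λ {x} x∈ → subst (_∈ g j) (indexOf-sepAt x)
            (h (subst (_∈ g i) (sym (indexOf-sepAt x)) x∈)))
            λ {x} x∈ → subst (_∈ g i) (indexOf-sepAt x) (back i j h
                (subst (_∈ g j) (sym (indexOf-sepAt x)) x∈)))
        ; index = find }
        where
        back : ∀ i j → (∀ {s} → indexOf s ∈ g i → indexOf s ∈ g j) → ∀ {s} → indexOf s ∈ g j → indexOf s ∈ g i
        back i j h {s} s∈ = Sum.[ (λ s∈i → s∈i) , (λ s*∈i →
            ⊥-elim (IsOrientation.consistent (sound j) s∈ (h s*∈i))) ]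
          (IsOrientation.total (sound i) (IsOrientation.within (sound j) s∈))

        find : ∀ {O} → Decidable O → IsOrientation O → ∃[ i ] (∀ s → indexOf s ∈ g i ⇔ O s)
        find {O} O? o = proj₁ hit , λ s → mk⇔ (λ h → from′ (subst (indexOf s ∈_) (proj₂ hit) h))
            (λ h → subst (indexOf s ∈_) (sym (proj₂ hit)) (to′ h))
          where
          C : Subset (proj₁ (finite-Sep {n}))
          C = comprehension (O? ∘ sepAt)
          to′ : ∀ {s} → O s → indexOf s ∈ C
          to′ {s} h = ∈comprehension⁺ (O? ∘ sepAt) (subst O (sym (sepAt-indexOf s)) h)
          from′ : ∀ {s} → indexOf s ∈ C → O s
          from′ {s} h = subst O (sepAt-indexOf s) (∈comprehension⁻ (O? ∘ sepAt) h)
          hit : ∃[ i ] g i ≡ C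
          hit = complete C record
            { within = within ∘ from′ ; total = Sum.map to′ to′ ∘ total
            ; consistent = λ h h* → consistent (from′ h) (from′ h*)
            ; downward = λ Nr r≤s h → to′ (downward Nr r≤s (from′ h)) }
            where open IsOrientation o

-- The tree of a nested set of separations

module NestedTree {n} (G : Graph n) (N : Pred (Sep n) 0ℓ) (N? : Decidable N)
  (N-swap : ∀ {s} → N s → N (swap s))
  (N-separation : ∀ {s} → N s → IsSeparation G s) (N-proper : ∀ {s} → N s → Proper s)
  (N-nested : ∀ {s r} → N s → N r → Nested s r)
  where

  open Orientations (orientations N N?)

  module _ {i : Fin m} where
    open IsOrientation (isOrientation i) public

  ¬total : ∀ {i s} → N s → ¬ i ∋ s → i ∋ swap s
  ¬total Ns i∌s = Sum.[ (λ i∋s → ⊥-elim (i∌s i∋s)) , (λ h → h) ] (total Ns)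

  -- Otherwise `C` would contain `A ∪ B`, that is every vertex, and `s` would not be proper.
  not-below-both : ∀ {r s} → N r → N s → r ≤ˢ s → ¬ swap r ≤ˢ s
  not-below-both {A , B} {C , D} Nr Ns (A⊆C , D⊆B) (B⊆C , D⊆A) =
    proj₂ (N-proper Ns) λ {v} _ → Sum.[ (λ v∈ → A⊆C v∈) , (λ v∈ → B⊆C v∈) ] (cover G (N-separation Nr) v)

  -- The separations pointing towards the head of s, that is r ≤ s or r < swap s.
  Below : Sep n → Pred (Sep n) 0ℓ
  Below s r = N r × (r ≤ˢ s ⊎ (r ≤ˢ swap s × r ≢ swap s))

  below-isOrientation : ∀ {s} → N s → IsOrientation N (Below s)
  below-isOrientation {s} Ns = record
    { within = proj₁
    ; total = λ {r} Nr → tot Nr (N-nested Nr Ns)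
    ; consistent = con
    ; downward = λ { Nr r≤t (Nt , inj₁ t≤s) → Nr , inj₁ (≤ˢ-trans r≤t t≤s)
                   ; {r} {t} Nr r≤t (Nt , inj₂ (t≤s* , t≢s*)) → Nr , inj₂ (≤ˢ-trans r≤t t≤s* ,
                       λ { refl → t≢s* (≤ˢ-antisym t≤s* r≤t) }) } }
    where
    strictly : ∀ {r} → N r → r ≤ˢ swap s → Below s r ⊎ Below s (swap r)
    strictly {r} Nr h with r ≟ˢ swap s
    ... | yes refl = inj₂ (Ns , inj₁ (≤ˢ-refl s))
    ... | no r≢    = inj₁ (Nr , inj₂ (h , r≢))

    tot : ∀ {r} → N r → Nested r s → Below s r ⊎ Below s (swap r)
    tot Nr (inj₁ (inj₁ r≤s))      = inj₁ (Nr , inj₁ r≤s)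
    tot Nr (inj₁ (inj₂ s≤r))      = Sum.swap (strictly (N-swap Nr) (swap-≤ˢ s≤r))
    tot Nr (inj₂ (inj₁ r≤s*))     = strictly Nr r≤s*
    tot {r} Nr (inj₂ (inj₂ s*≤r)) = inj₂ (N-swap Nr , inj₁ (swap-≤ˢ {s = swap s} {r} s*≤r))

    con : ∀ {r} → Below s r → ¬ Below s (swap r)
    con {r} (Nr , inj₁ a) (_ , inj₁ b)         = not-below-both Nr Ns a b
    con {r} (Nr , inj₁ a) (_ , inj₂ (b , b≢))  = b≢ (cong swap (≤ˢ-antisym a (swap-≤ˢ b)))
    con {r} (Nr , inj₂ (a , a≢)) (_ , inj₁ b)  = a≢ (≤ˢ-antisym a (swap-≤ˢ {s = swap r} {s} b))
    con {r} (Nr , inj₂ (a , _)) (_ , inj₂ (b , _)) = not-below-both Nr (N-swap Ns) a b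

  below? : ∀ s → Decidable (Below s)
  below? s r = N? r ×-dec (r ≤ˢ? s ⊎-dec (r ≤ˢ? swap s ×-dec ¬? (r ≟ˢ swap s)))

  MaximalIn : Fin m → Pred (Sep n) 0ℓ
  MaximalIn i s = i ∋ s × (∀ {r} → i ∋ r → s ≤ˢ r → r ≡ s)

  head-of : ∀ {s} → N s → ∃[ i ] MaximalIn i s
  head-of {s} Ns = let i , i⇔ = index (below? s) (below-isOrientation Ns) in
    i , Equivalence.from (i⇔ s) (Ns , inj₁ (≤ˢ-refl s)) , λ {r} i∋r s≤r →
        maximal r (Equivalence.to (i⇔ r) i∋r) s≤r
    where
    maximal : ∀ r → Below s r → s ≤ˢ r → r ≡ s
    maximal r (_ , inj₁ r≤s) s≤r = ≤ˢ-antisym r≤s s≤r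
    maximal r (_ , inj₂ (r≤s* , _)) s≤r =
        ⊥-elim (proj₁ (N-proper Ns) (proj₁ (≤ˢ-trans {s = s} {r} {swap s} s≤r r≤s*)))

  root : Fin m
  root with any? finite-Sep N?
  ... | yes (_ , Ns) = proj₁ (head-of Ns)
  -- With `N` empty, the empty set is the only orientation and the tree is a single node.
  ... | no ∄ = proj₁ (index N? record
    { within = id ; total = inj₁ ; consistent = λ Ns → ⊥-elim (∄ (_ , Ns)) ; downward = λ Nr _ _ → Nr })

  -- Flipping a maximal element: the edges of the tree

  Flip : Fin m → Sep n → Fin m → Set
  Flip i s j = i ∋ s × j ∋ swap s × (∀ r → i ∋ r → r ≢ s → j ∋ r)

  flip-sym : ∀ {i s j} → Flip i s j → Flip j (swap s) i
  flip-sym {i} {s} {j} (i∋s , j∋s* , h) = j∋s* , i∋s , λ r j∋r r≢s* →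
    decidable-stable (i ∋? r) λ i∌r → consistent j∋r
        (h (swap r) (¬total (within j∋r) i∌r) λ e → r≢s* (cong swap e))

  -- A larger element would survive the flip and, as `j` is closed downwards, bring `s` back with
  -- it.
  flip-maximal : ∀ {i s j} → Flip i s j → MaximalIn i s
  flip-maximal {i} {s} {j} (i∋s , j∋s* , h) = i∋s , λ {r} i∋r s≤r → decidable-stable (r ≟ˢ s) λ r≢s →
    consistent (downward (within i∋s) s≤r (h r i∋r r≢s)) j∋s*

  -- Since N is nested, an orientation is determined by any of its maximal elements.
  maximal-determines : ∀ {i j s} → MaximalIn i s → MaximalIn j s → i ≡ j
  maximal-determines {i} {j} {s} (i∋s , i-max) (j∋s , j-max) =
      ∋-injective λ {r} i∋r → go i∋r (N-nested (within i∋r) (within i∋s))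
    where
    go : ∀ {r} → i ∋ r → Nested r s → j ∋ r
    go i∋r (inj₁ (inj₁ r≤s)) = downward (within i∋r) r≤s j∋s
    go i∋r (inj₁ (inj₂ s≤r)) = subst (j ∋_) (sym (i-max i∋r s≤r)) j∋s
    go {r} i∋r (inj₂ (inj₁ r≤s*)) = decidable-stable (j ∋? r) λ j∌r →
      consistent i∋s (subst (i ∋_)
          (cong swap (j-max (¬total (within i∋r) j∌r) (swap-≤ˢ {s = r} {swap s} r≤s*))) i∋r)
    go {r} i∋r (inj₂ (inj₂ s*≤r)) =
        ⊥-elim (consistent i∋r (downward (N-swap (within i∋r)) (swap-≤ˢ {s = swap s} {r} s*≤r) i∋s))

  -- Each element of `N` thus labels a single directed edge. Acyclicity and the computation of the
  -- sides both rest on this.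
  flip-determines : ∀ {i i′ s j j′} → Flip i s j → Flip i′ s j′ → i ≡ i′ × j ≡ j′
  flip-determines f f′ = maximal-determines (flip-maximal f) (flip-maximal f′) ,
    maximal-determines (flip-maximal (flip-sym f)) (flip-maximal (flip-sym f′))

  module _ {i : Fin m} {s : Sep n} (maximal : MaximalIn i s) where
    private
      i∋s = proj₁ maximal
      i-max = λ {r} → proj₂ maximal {r}
      Ns = within i∋s

      O : Pred (Sep n) 0ℓ
      O r = (i ∋ r × r ≢ s) ⊎ r ≡ swap s

      O? : Decidable O
      O? r = (i ∋? r ×-dec ¬? (r ≟ˢ s)) ⊎-dec r ≟ˢ swap s

      O-isOrientation : IsOrientation N O
      O-isOrientation = record
        { within = λ { (inj₁ (i∋r , _)) → within i∋r ; (inj₂ refl) → N-swap Ns }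
        ; total = λ {r} → tot {r} ; consistent = λ {r} → con {r} ; downward = down }
        where
        tot : ∀ {r} → N r → O r ⊎ O (swap r)
        tot {r} Nr with r ≟ˢ s | r ≟ˢ swap s | i ∋? r
        ... | yes refl | _ | _ = inj₂ (inj₂ refl)
        ... | _ | yes e | _ = inj₁ (inj₂ e)
        ... | no r≢s | _ | yes i∋r = inj₁ (inj₁ (i∋r , r≢s))
        ... | _ | no r≢s* | no i∌r = inj₂ (inj₁ (¬total Nr i∌r , λ e → r≢s* (cong swap e)))

        con : ∀ {r} → O r → ¬ O (swap r)
        con (inj₁ (a , _)) (inj₁ (b , _)) = consistent a b
        con (inj₁ (_ , r≢s)) (inj₂ e) = r≢s (cong swap e)
        con (inj₂ refl) (inj₁ (_ , s≢s)) = s≢s refl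
        con (inj₂ refl) (inj₂ e) = consistent i∋s (subst (i ∋_) e i∋s)

        down : ∀ {r t} → N r → r ≤ˢ t → O t → O r
        down {r} {t} Nr r≤t (inj₁ (i∋t , t≢s)) = inj₁ (downward Nr r≤t i∋t , λ { refl → t≢s (i-max i∋t r≤t) })
        down {r} Nr r≤s* (inj₂ refl) with r ≟ˢ swap s | i ∋? r
        ... | yes e | _ = inj₂ e
        ... | no _ | yes i∋r = inj₁ (i∋r , λ { refl → proj₁ (N-proper Ns) (proj₁ r≤s*) })
        ... | no r≢s* | no i∌r =
              ⊥-elim (r≢s* (cong swap (i-max (¬total Nr i∌r) (swap-≤ˢ {s = r} {swap s} r≤s*))))

    -- Exchanging `s` for `swap s` preserves closure downwards. No other element lies above `s`; and
    -- anything strictly below `swap s` was already present, for its inverse lies strictly above the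
    -- maximal `s`.
    flip-exists : ∃[ j ] Flip i s j
    flip-exists = let j , j⇔ = index O? O-isOrientation in
      j , i∋s , Equivalence.from (j⇔ (swap s)) (inj₂ refl) , λ r i∋r r≢s →
          Equivalence.from (j⇔ r) (inj₁ (i∋r , r≢s))

  Edge : Rel (Fin m) 0ℓ
  Edge i j = ∃[ s ] Flip i s j

  edge? : Binary.Decidable Edge
  edge? i j = any? finite-Sep λ s → i ∋? s ×-dec (j ∋? swap s ×-dec
    all? finite-Sep λ r → i ∋? r →-dec (¬? (r ≟ˢ s) →-dec j ∋? r))

  tree : Graph m
  tree = record
    { Adj    = Edge
    ; adj?   = edge?
    ; sym    = λ (s , f) → swap s , flip-sym f
    ; irrefl = λ { refl (s , i∋s , i∋s* , _) → consistent i∋s i∋s* } }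

  -- Walks that remove unwanted separations from an orientation

  module _ (Bad : Pred (Sep n) 0ℓ) (Bad? : Decidable Bad)
    (upward : ∀ {r s} → N r → N s → r ≤ˢ s → Bad r → Bad s)
    (one-bad : ∀ {s} → N s → Bad s → ¬ Bad (swap s)) where

    private
      sepAt = Inverse.from (proj₂ (finite-Sep {n}))
      indexOf = Inverse.to (proj₂ (finite-Sep {n}))
      sepAt-indexOf = Inverse.strictlyInverseʳ (proj₂ (finite-Sep {n}))

      bad? : ∀ i → Decidable (λ x → i ∋ sepAt x × Bad (sepAt x))
      bad? i x = i ∋? sepAt x ×-dec Bad? (sepAt x)

      bads : Fin m → Subset _
      bads i = comprehension (bad? i)

    -- `Bad s` will mean that a target orientation lacks `s`, or that a fixed vertex set is not
    -- contained in the right side of `s`. The last component, survival of the good elements of `i`,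
    -- keeps the walk a path and confines it to one side of each of them.
    GoodWalk : Fin m → Set
    GoodWalk i = ∃₂ λ j p → Path Edge i p j × (∀ {r} → j ∋ r → ¬ Bad r) ×
      (∀ {t} → t ∈ˡ p → ∀ {r} → i ∋ r → ¬ Bad r → t ∋ r)

    private
      flip-fewer : ∀ {i s j} → Bad s → Flip i s j → bads j ⊂ bads i
      flip-fewer {i} {s} {j} bad f@(i∋s , j∋s* , _) =
        (λ {x} x∈ → ∈comprehension⁺ (bad? i) (old (sepAt x) (∈comprehension⁻ (bad? j) x∈))) ,
        indexOf s , ∈comprehension⁺ (bad? i) (subst (λ t → i ∋ t × Bad t) (sym (sepAt-indexOf s)) (i∋s , bad)) ,
        λ s∈ → consistent (subst (j ∋_) (sepAt-indexOf s) (proj₁ (∈comprehension⁻ (bad? j) s∈))) j∋s*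
        where
        old : ∀ r → j ∋ r × Bad r → i ∋ r × Bad r
        old r (j∋r , b) = proj₂ (proj₂ (flip-sym f)) r j∋r (λ { refl → one-bad (within i∋s) bad b }) , b

      goodWalk-cons : ∀ {i s j} → Bad s → Flip i s j → GoodWalk j → GoodWalk i
      goodWalk-cons {i} {s} bad f@(i∋s , j∋s* , keep) (l , p , path , good , stay) = l , i ∷ p ,
        -- The good `swap s` of `j` survives at all later nodes, whereas `i` contains `s`; hence the
        -- walk never returns to `i`.
        cons (s , f) (λ i∈p → consistent i∋s (stay i∈p j∋s* (one-bad (within i∋s) bad))) path , good ,
        λ { (here refl) i∋r _ → i∋r
          ; (there t∈) {r} i∋r ok → stay t∈ (keep r i∋r (λ { refl → ok bad })) ok }

    -- Keep flipping maximal bad elements, which turns them into good ones.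
    goodWalk : ∀ i → GoodWalk i
    goodWalk i = go i (⊂-wellFounded (bads i))
      where
      go : ∀ i → Acc _⊂_ (bads i) → GoodWalk i
      go i (acc rec) with any? finite-Sep (λ s → i ∋? s ×-dec Bad? s)
      ... | no ∄ = i , _ , [ i ] , (λ {r} i∋r b → ∄ (r , i∋r , b)) , λ { (here refl) i∋r _ → i∋r }
      ... | yes (_ , q) =
        let s , (i∋s , bad) , _ , max = maximal-above (λ s → i ∋? s ×-dec Bad? s) q
            j , f = flip-exists (i∋s , λ {r} i∋r s≤r → max r
                (i∋r , upward (within i∋s) (within i∋r) s≤r bad) s≤r)
        in goodWalk-cons bad f (go j (rec (flip-fewer bad f)))

  -- The tree-decomposition

  -- Removing all that `j` lacks ends in an orientation contained in `j`, hence equal to it.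
  connected : ∀ i j → ∃[ p ] IsPath Edge i p j
  connected i j =
    let l , p , path , good , _ = goodWalk (λ s → ¬ j ∋ s) (λ s → ¬? (j ∋? s))
          (λ Nr Ns r≤s j∌r j∋s → j∌r (downward Nr r≤s j∋s))
          (λ Ns j∌s j∌s* → j∌s* (¬total Ns j∌s)) i
        l≡j = ∋-injective λ {s} l∋s → decidable-stable (j ∋? s) (good l∋s)
    in p , path⇒isPath (subst (Path Edge i p) l≡j path)

  flip-keeps : ∀ {i j a b s} → Flip i s j → Edge a b → a ∋ s → (a ≢ i ⊎ b ≢ j) → b ∋ s
  flip-keeps {s = s} f (q , g@(_ , _ , keep)) a∋s h with q ≟ˢ s
  ... | no q≢s = keep s a∋s (λ e → q≢s (sym e))
  ... | yes refl = ⊥-elim (Sum.[ (λ a≢i → a≢i (proj₁ (flip-determines g f))) ,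
        (λ b≢j → b≢j (proj₂ (flip-determines g f))) ] h)

  -- The first edge, from `v` to `w`, turns `s` into `swap s`. Only the step from `w` back to `v`
  -- could undo this, and the rest of the cycle does not use it; so `v` would contain `swap s` as
  -- well as `s`.
  acyclic : ∀ c → ¬ IsCycle Edge c
  acyclic _ (s≤s (s≤s (s≤s _)) , (v≢w ∷ v≢y ∷ v∉) ∷ (w∉ ∷ _) , v , w ∷ y ∷ ys , refl ,
      (s , f@(v∋s , w∋s* , _)) ∷ e ∷ l) =
    consistent v∋s (stay (flip-keeps (flip-sym f) e w∋s* (inj₂ λ { refl → v≢y refl })) w∉ l)
    where
    stay : ∀ {x xs} → x ∋ swap s → All (w ≢_) (x ∷ xs) → Linked Edge (x ∷ xs ++ v ∷ []) → v ∋ swap s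
    stay {xs = []} x∋ (w≢x ∷ _) (e ∷ _) = flip-keeps (flip-sym f) e x∋ (inj₁ λ { refl → w≢x refl })
    stay {xs = _ ∷ _} x∋ (w≢x ∷ w≢) (e ∷ l) = stay
        (flip-keeps (flip-sym f) e x∋ (inj₁ λ { refl → w≢x refl })) w≢ l

  isTree : IsTree tree
  isTree = root , connected , acyclic

  -- The axiom `between` for orientations: a path enters the set of nodes containing `s` by the one
  -- edge across `s`, and cannot use this edge again to leave.
  path-convex : ∀ {i p l} → Path Edge i p l → ∀ {j s} → j ∈ˡ p → j ∋ s → i ∋ s ⊎ l ∋ s
  path-convex [ _ ] (here refl) j∋s = inj₁ j∋s
  path-convex (cons _ _ _) (here refl) j∋s = inj₁ j∋s
  path-convex {i} (cons {y = x} (q , f@(_ , _ , keep)) i∉ p) {j} {s} (there j∈) j∋s with i ∋? s | x ∋? s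
  ... | yes i∋s | _ = inj₁ i∋s
  ... | no i∌s | no x∌s = inj₂ (Sum.[ (λ x∋s → ⊥-elim (x∌s x∋s)) , (λ h → h) ] (path-convex p j∈ j∋s))
  ... | no i∌s | yes x∋s = inj₂ (stay p i∉ x∋s)
    where
    -- The edge from i is the only one across s.
    q≡s* : q ≡ swap s
    q≡s* = decidable-stable (q ≟ˢ swap s) λ q≢ → consistent x∋s
        (keep (swap s) (¬total (within j∋s) i∌s) λ e → q≢ (sym e))
    g : Flip x s i
    g = subst (λ q → Flip x (swap q) i) q≡s* (flip-sym f)
    stay : ∀ {a p l} → Path Edge a p l → i ∉ˡ p → a ∋ s → l ∋ s
    stay [ _ ] _ a∋s = a∋s
    stay (cons e _ p) i∉ a∋s = stay p (i∉ ∘ there)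
        (flip-keeps g e a∋s (inj₂ λ { refl → i∉ (there (path-start p)) }))

  InPart : Fin m → Fin n → Set
  InPart i v = ∀ s → i ∋ s → v ∈ proj₂ s

  inPart? : ∀ i → Decidable (InPart i)
  inPart? i v = all? finite-Sep λ s → i ∋? s →-dec v ∈? proj₂ s

  part : Fin m → Subset n
  part i = comprehension (inPart? i)

  part⊆ : ∀ {i s} → i ∋ s → part i ⊆ proj₂ s
  part⊆ {i} {s} i∋s v∈ = ∈comprehension⁻ (inPart? i) v∈ s i∋s

  ⊆part : ∀ {i X} → (∀ {s} → i ∋ s → X ⊆ proj₂ s) → X ⊆ part i
  ⊆part {i} h v∈ = ∈comprehension⁺ (inPart? i) λ s i∋s → h i∋s v∈

  -- Here an element is bad if its right side does not contain `X`, so the walk ends where all right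
  -- sides do. As `X` is unsplit, `s` and `swap s` are never both bad. Single vertices, edges and
  -- blocks are such sets.
  walk-to-part : ∀ {X} → (∀ {s} → N s → X ⊆ proj₁ s ⊎ X ⊆ proj₂ s) → ∀ i →
    ∃₂ λ j p → Path Edge i p j × X ⊆ part j × (∀ {t} → t ∈ˡ p → ∀ {r} → i ∋ r → X ⊆ proj₂ r → t ∋ r)
  walk-to-part {X} unsplit i =
    let j , p , path , good , stay = goodWalk (λ s → ¬ X ⊆ proj₂ s) (λ s → ¬? (X ⊆? proj₂ s))
          (λ { _ _ (_ , D⊆B) X⊈B X⊆D → X⊈B λ x∈ → D⊆B (X⊆D x∈) })
          (λ {s} Ns X⊈B X⊈A → Sum.[ (λ X⊆A → X⊈A λ {x} → X⊆A {x}) ,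
              (λ X⊆B → X⊈B λ {x} → X⊆B {x}) ] (unsplit Ns)) i
    in j , p , path , ⊆part (λ {s} j∋s → decidable-stable (X ⊆? proj₂ s) (good j∋s)) , λ t∈ i∋r X⊆ →
          stay t∈ i∋r λ X⊈ → X⊈ λ {x} → X⊆ {x}

  pair⊆ : {u v : Fin n} {X : Subset n} → u ∈ X → v ∈ X → ⁅ u ⁆ ∪ ⁅ v ⁆ ⊆ X
  pair⊆ {u} {v} {X} u∈ v∈ w∈ = Sum.[ (λ w∈u → subst (_∈ X) (sym (x∈⁅y⁆⇒x≡y u w∈u)) u∈) ,
      (λ w∈v → subst (_∈ X) (sym (x∈⁅y⁆⇒x≡y v w∈v)) v∈) ]
    (x∈p∪q⁻ ⁅ u ⁆ ⁅ v ⁆ w∈)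

  singleton-unsplit : ∀ v {s} → N s → ⁅ v ⁆ ⊆ proj₁ s ⊎ ⁅ v ⁆ ⊆ proj₂ s
  singleton-unsplit v {s} Ns = Sum.map ⁅v⁆⊆ ⁅v⁆⊆ (cover G (N-separation Ns) v)
    where
    ⁅v⁆⊆ : ∀ {X} → v ∈ X → ⁅ v ⁆ ⊆ X
    ⁅v⁆⊆ {X} v∈ u∈ = subst (_∈ X) (sym (x∈⁅y⁆⇒x≡y v u∈)) v∈

  edge-unsplit : ∀ {u v} → Adj G u v → ∀ {s} → N s → ⁅ u ⁆ ∪ ⁅ v ⁆ ⊆ proj₁ s ⊎ ⁅ u ⁆ ∪ ⁅ v ⁆ ⊆ proj₂ s
  edge-unsplit {u} {v} e {s@(A , B)} Ns with u ∈? A | v ∈? A | u ∈? B | v ∈? B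
  ... | yes a | yes b | _ | _ = inj₁ (pair⊆ a b)
  ... | _ | _ | yes a | yes b = inj₂ (pair⊆ a b)
  ... | no u∉A | _ | _ | no v∉B = ⊥-elim (no-edge G (N-separation Ns) v∉B u∉A (Graph.sym G e))
  ... | no u∉A | _ | no u∉B | _ = ⊥-elim (u∉A (∉proj₂⇒∈proj₁ G (N-separation Ns) u∉B))
  ... | _ | no v∉A | no u∉B | _ = ⊥-elim (no-edge G (N-separation Ns) u∉B v∉A e)
  ... | _ | no v∉A | _ | no v∉B = ⊥-elim (v∉A (∉proj₂⇒∈proj₁ G (N-separation Ns) v∉B))

  decomposition : TreeDecomposition G
  decomposition = record
    { tree    = tree
    ; isTree  = isTree
    ; part    = part
    ; covers  = λ v → let j , _ , _ , v∈ , _ = walk-to-part (singleton-unsplit v) root in j , v∈ (x∈⁅x⁆ v)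
    ; edges   = λ u v e → let j , _ , _ , uv⊆ , _ = walk-to-part (edge-unsplit e) root in
                  j , uv⊆ (p⊆p∪q ⁅ v ⁆ (x∈⁅x⁆ u)) , uv⊆ (q⊆p∪q ⁅ u ⁆ ⁅ v ⁆ (x∈⁅x⁆ v))
    ; between = λ i j l p path j∈ {v} v∈ → let v∈i , v∈l = x∈p∩q⁻ (part i) (part l) v∈ in
                  ∈comprehension⁺ (inPart? j) λ s j∋s →
                    Sum.[ (λ i∋s → part⊆ i∋s v∈i) , (λ l∋s → part⊆ l∋s v∈l) ]
                        (path-convex (isPath⇒path path) j∈ j∋s) }

  -- Only the deleted edge flips `s`, so all nodes in the component of `i` contain `s` and their
  -- parts lie in its right side. Conversely, for a vertex of that side, `walk-to-part` gives a walk
  -- from `i` that retains `s` and so avoids the deleted edge.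
  flip-side : ∀ {i s j} → Flip i s j → IsSide G decomposition i j (proj₂ s)
  flip-side {i} {s} {j} f@(i∋s , j∋s* , _) v = mk⇔ to from
    where
    to : v ∈ proj₂ s → ∃[ t ] (∃[ p ] IsPath (AdjWithout G decomposition i j) i p t) × v ∈ part t
    to v∈B = let t , p , path , v∈t , stay = walk-to-part (singleton-unsplit v) i
                 s∈ : ∀ {t} → t ∈ˡ p → t ∋ s
                 s∈ t∈ = stay t∈ i∋s λ u∈ → subst (_∈ proj₂ s) (sym (x∈⁅y⁆⇒x≡y v u∈)) v∈B
             in t , (p , path⇒isPath (path-map (λ u∈ w∈ e → e ,
                  (λ { (_ , refl) → consistent (s∈ w∈) j∋s* }) ,
                      (λ { (refl , _) → consistent (s∈ u∈) j∋s* })) path)) ,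
                v∈t (x∈⁅x⁆ v)
    stay : ∀ {a p t} → Path (AdjWithout G decomposition i j) a p t → a ∋ s → t ∋ s
    stay [ _ ] a∋s = a∋s
    stay (cons {x = a} {b} (e@(q , g@(_ , _ , keep)) , ¬ij , _) _ p) a∋s = stay p (case q ≟ˢ s of λ where
      (no q≢s)   → keep s a∋s λ e → q≢s (sym e)
      (yes refl) → ⊥-elim (¬ij (flip-determines g f)))
    from : ∃[ t ] (∃[ p ] IsPath (AdjWithout G decomposition i j) i p t) × v ∈ part t → v ∈ proj₂ s
    from (t , (p , path) , v∈t) = part⊆ (stay (isPath⇒path path) i∋s) v∈t

  isSide-unique : ∀ {i j A A′} → IsSide G decomposition i j A → IsSide G decomposition i j A′ → A ≡ A′
  isSide-unique side side′ = ⊆-antisym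
    (λ {v} v∈ → Equivalence.from (side′ v) (Equivalence.to (side v) v∈))
    (λ {v} v∈ → Equivalence.from (side v) (Equivalence.to (side′ v) v∈))

  induced⇒N : ∀ {s} → Induced G decomposition s → N s
  induced⇒N {A , B} (i , j , (s , f) , sideA , sideB) = subst N
    (cong₂ _,_ (isSide-unique {i} {j} (flip-side f) sideA)
        (isSide-unique {j} {i} (flip-side (flip-sym f)) sideB))
    (N-swap (within (proj₁ f)))

  N⇒induced : ∀ {s} → N s → Induced G decomposition s
  N⇒induced Ns = let i , max = head-of Ns ; j , f = flip-exists max in
    -- `i` points to the second side of `s`, so the edge has to be read from `j` to `i`.
    j , i , (_ , flip-sym f) , flip-side (flip-sym f) , flip-side f

  part-one-side : ∀ {s} t → N s → part t ⊆ proj₁ s ⊎ part t ⊆ proj₂ s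
  part-one-side t Ns = Sum.swap (Sum.map (λ t∋s → part⊆ t∋s) (λ t∋s* → part⊆ t∋s*) (total Ns))

  -- Every maximal element of the orientation `t` can be flipped and yields a neighbour of `t`. A
  -- leaf has only one neighbour, hence only one maximal element `s`, and all its elements lie below
  -- `s`.
  leaf-separation : ∀ {t} → IsLeaf tree t →
    ∃[ s ] N s × (∀ r → N r → s ≤ˢ r → r ≡ s) × proj₂ s ⊆ part t
  leaf-separation {t} (u , (s , f@(t∋s , u∋s* , keep)) , unique) =
      s , within t∋s , maximal , ⊆part (λ {r} t∋r → proj₂ (below r t∋r))
    where
    below : ∀ r → t ∋ r → r ≤ˢ s
    below r t∋r = let q , t∋q , r≤q , q-max = maximal-above (t ∋?_) t∋r
                      j , g@(_ , j∋q* , _) = flip-exists (t∋q , λ {x} → q-max x)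
                      q≡s = decidable-stable (q ≟ˢ s) λ q≢s → consistent (keep q t∋q q≢s)
                          (subst (_∋ swap q) (sym (unique (_ , g))) j∋q*)
                  in subst (r ≤ˢ_) q≡s r≤q
    maximal : ∀ r → N r → s ≤ˢ r → r ≡ s
    maximal r Nr s≤r with t ∋? r
    ... | yes t∋r = ≤ˢ-antisym (below r t∋r) s≤r
    ... | no t∌r = ⊥-elim
          (proj₂ (N-proper Nr) (proj₁ (≤ˢ-trans {s = swap r} {s} {r} (below (swap r) (¬total Nr t∌r)) s≤r)))

  -- Automorphisms acting on the tree

  module _ (α : Permutation′ n) (N-image : ∀ {s} → N s → N (imageˢ α s))
      (N-image′ : ∀ {s} → N s → N (imageˢ (flip α) s)) where

    private
      pulled : ∀ i → IsOrientation N (λ s → i ∋ imageˢ (flip α) s)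
      pulled i = record
        { within = λ {s} i∋ → subst N (imageˢ-flip α s) (N-image (within i∋))
        ; total = λ Ns → total (N-image′ Ns)
        ; consistent = consistent
        ; downward = λ Nr r≤s → downward (N-image′ Nr) (imageˢ-mono (flip α) r≤s) }

    move : Fin m → Fin m
    move i = proj₁ (index (λ s → i ∋? imageˢ (flip α) s) (pulled i))

    move⇔ : ∀ i s → move i ∋ s ⇔ i ∋ imageˢ (flip α) s
    move⇔ i = proj₂ (index (λ s → i ∋? imageˢ (flip α) s) (pulled i))

    move-∋ : ∀ {i s} → i ∋ s → move i ∋ imageˢ α s
    move-∋ {i} {s} i∋s = Equivalence.from (move⇔ i _) (subst (i ∋_) (sym (flip-imageˢ α s)) i∋s)

    move-edge : ∀ {i j} → Edge i j → Edge (move i) (move j)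
    move-edge {i} {j} (s , i∋s , j∋s* , keep) = imageˢ α s , move-∋ i∋s , move-∋ j∋s* , λ r i∋r r≢ →
      Equivalence.from (move⇔ j r) (keep _ (Equivalence.to (move⇔ i r) i∋r)
        λ e → r≢ (trans (sym (imageˢ-flip α r)) (cong (imageˢ α) e)))

    part-move : ∀ i → image α (part i) ≡ part (move i)
    part-move i = ⊆-antisym
      (λ {v} v∈ → ∈comprehension⁺ (inPart? (move i)) λ s mi∋s →
        subst (v ∈_) (image-flip α (proj₂ s)) (∈image⁺ α
            (part⊆ (Equivalence.to (move⇔ i s) mi∋s) (∈image⁻ α v∈))))
      (λ {v} v∈ → ∈image⁺ α (∈comprehension⁺ (inPart? i) λ s i∋s → ∈image⁻ α (part⊆ (move-∋ i∋s) v∈)))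

  -- Invariance is required for every `α` because the inverse of `move` for `α` is `move` for
  -- `flip α`.
  canonical : ∀ {S} → (∀ α → IsAutomorphism G α → ActsOn α S → ∀ {s} → N s → N (imageˢ α s)) →
    (∀ α → ActsOn α S → ActsOn (flip α) S) → Canonical G decomposition S
  canonical {S} invariant acts-flip α auto acts = permutation φ φ⁻¹ φφ⁻¹ φ⁻¹φ ,
      (λ u v → mk⇔ (move-edge α I I′) (λ e → subst₂ Edge (φ⁻¹φ u) (φ⁻¹φ v) (move-edge (flip α) I′ I″ e))) ,
          part-move α I I′
    where
    I = λ {s} → invariant α auto acts {s}
    I′ = λ {s} → invariant (flip α) (flip-isAutomorphism G α auto) (acts-flip α acts) {s}
    I″ : ∀ {s} → N s → N (imageˢ (flip (flip α)) s)
    I″ = I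
    φ = move α I I′
    φ⁻¹ = move (flip α) I′ I″
    φφ⁻¹ : ∀ i → φ (φ⁻¹ i) ≡ i
    φφ⁻¹ i = sym (∋-injective λ {s} i∋s → subst (φ (φ⁻¹ i) ∋_) (imageˢ-flip α s)
        (move-∋ α I I′ (move-∋ (flip α) I′ I″ i∋s)))
    φ⁻¹φ : ∀ i → φ⁻¹ (φ i) ≡ i
    φ⁻¹φ i = sym (∋-injective λ {s} i∋s → subst (φ⁻¹ (φ i) ∋_) (flip-imageˢ α s)
        (move-∋ (flip α) I′ I″ (move-∋ α I I′ i∋s)))

-- The separations induced by a tree-decomposition

module InducedSeparations {n} (G : Graph n) (𝒟 : TreeDecomposition G) where
  open TreeDecomposition 𝒟

  private
    Tᴬ = Adj tree

    Without : Fin m → Fin m → Rel (Fin m) 0ℓ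
    Without = AdjWithout G 𝒟

  without? : ∀ i j → Binary.Decidable (Without i j)
  without? i j u v = Graph.adj? tree u v ×-dec (¬? (u Fin.≟ i ×-dec v Fin.≟ j) ×-dec ¬?
      (u Fin.≟ j ×-dec v Fin.≟ i))

  without-sym : ∀ {i j u v} → Without i j u v → Without i j v u
  without-sym (e , a , b) = Graph.sym tree e , (λ (p , q) → b (q , p)) , (λ (p , q) → a (q , p))

  without-swap : ∀ {i j u v} → Without i j u v → Without j i u v
  without-swap (e , a , b) = e , b , a

  Reachable : Fin m → Fin m → Pred (Fin m) 0ℓ
  Reachable i j t = Star (Without i j) i t

  avoiding : ∀ {i j u p v} → i ∉ˡ p → Path Tᴬ u p v → Star (Without i j) u v
  avoiding i∉ path = path⇒star (path-map (λ u∈ v∈ e → e , (λ { (refl , _) → i∉ u∈ }) ,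
      (λ { (_ , refl) → i∉ v∈ })) path)

  adj⇒≢ : ∀ {i j} → Tᴬ i j → i ≢ j
  adj⇒≢ e i≡j = Graph.irrefl tree i≡j e

  -- A path starting at `i` never returns there, so it can use the edge `ij` only as its first step.
  reachable-either : ∀ {i j} → Tᴬ i j → ∀ t → Reachable i j t ⊎ Reachable j i t
  reachable-either {i} {j} e t = go (isPath⇒path (proj₂ (proj₁ (proj₂ isTree) i t)))
    where
    go : ∀ {p} → Path Tᴬ i p t → Reachable i j t ⊎ Reachable j i t
    go [ _ ] = inj₁ ε
    go (cons {y = x} e′ i∉ path) with x Fin.≟ j
    ... | yes refl = inj₂ (gmap id without-swap (avoiding i∉ path))
    ... | no x≢j   = inj₁ ((e′ , (λ (_ , x≡j) → x≢j x≡j) , λ (i≡j , _) → adj⇒≢ e i≡j) ◅ avoiding i∉ path)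

  linked-snoc : ∀ {R : Rel (Fin m) 0ℓ} {x p y z} → Path R x p y → R y z → Linked R (p ++ z ∷ [])
  linked-snoc [ _ ] r = r ∷ [-]
  linked-snoc (cons r _ p@([ _ ])) r′ = r ∷ linked-snoc p r′
  linked-snoc (cons r _ p@(cons _ _ _)) r′ = r ∷ linked-snoc p r′

  -- A common node would give a path from `i` to `j` without the edge `ij`, which this edge closes
  -- to a cycle.
  reachable-exclusive : ∀ {i j} → Tᴬ i j → ∀ {t} → Reachable i j t → ¬ Reachable j i t
  reachable-exclusive {i} {j} e rs rs′ =
      go (proj₂ (star⇒path (rs ◅◅ reverse without-sym (gmap id without-swap rs′))))
    where
    go : ∀ {p} → ¬ Path (Without i j) i p j
    go [ _ ] = adj⇒≢ e refl
    go (cons (_ , ¬ij , _) _ [ _ ]) = ¬ij (refl , refl)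
    go {p} path@(cons _ _ (cons _ _ path′)) = proj₂ (proj₂ isTree) p
        (long path′ , proj₂ (proj₂ (proj₂ (path⇒isPath path))) ,
      _ , _ , refl , linked-snoc (path-map (λ _ _ → proj₁) path) (Graph.sym tree e))
      where
      long : ∀ {x p y} → Path (Without i j) x p y → 3 ≤ 2 ℕ.+ length p
      long [ _ ]        = ℕ.≤-refl
      long (cons _ _ _) = s≤s (s≤s (s≤s ℕ.z≤n))

  -- The edge kl lies in the component of i in T - ij, so the other component is connected in T - kl.
  reachable-⊆ : ∀ {i j k l} → Tᴬ i j → ¬ (i ≡ k × j ≡ l) → ¬ (i ≡ l × j ≡ k) →
    Reachable i j k → Reachable k l i → ∀ {t} → Reachable j i t → Reachable k l t
  reachable-⊆ {i} {j} {k} {l} e ≢kl ≢lk i⇝k k⇝i j⇝t = k⇝i ◅◅ (e , ≢kl , ≢lk) ◅ go ε j⇝t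
    where
    k-far : ∀ {u} → Reachable j i u → u ≢ k
    k-far j⇝u refl = reachable-exclusive e i⇝k j⇝u
    go : ∀ {u t} → Reachable j i u → Star (Without j i) u t → Star (Without k l) u t
    go j⇝u ε = ε
    go j⇝u (r ◅ rs) = (proj₁ r , (λ (u≡k , _) → k-far j⇝u u≡k) , (λ (_ , w≡k) → k-far j⇝w w≡k)) ◅ go j⇝w rs
      where j⇝w = j⇝u ◅◅ (r ◅ ε)

  OnSide : Fin m → Fin m → Pred (Fin n) 0ℓ
  OnSide i j v = ∃[ t ] (∃[ p ] IsPath (Without i j) i p t) × v ∈ part t

  onSide? : ∀ i j → Decidable (OnSide i j)
  onSide? i j v = Fin.any? λ t → map′ (λ rs → let p , path = star⇒path rs in p , path⇒isPath path)
    (λ (p , path) → path⇒star (isPath⇒path path)) (star? (without? i j) i t) ×-dec v ∈? part t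

  onSide⁺ : ∀ {i j t v} → Reachable i j t → v ∈ part t → OnSide i j v
  onSide⁺ rs v∈ = let p , path = star⇒path rs in _ , (p , path⇒isPath path) , v∈

  onSide⁻ : ∀ {i j v} → OnSide i j v → ∃[ t ] Reachable i j t × v ∈ part t
  onSide⁻ (t , (p , path) , v∈) = t , path⇒star (isPath⇒path path) , v∈

  abstract
    side : Fin m → Fin m → Subset n
    side i j = comprehension (onSide? i j)

    ∈side⁺ : ∀ {i j v} → OnSide i j v → v ∈ side i j
    ∈side⁺ {i} {j} = ∈comprehension⁺ (onSide? i j)

    ∈side⁻ : ∀ {i j v} → v ∈ side i j → OnSide i j v
    ∈side⁻ {i} {j} = ∈comprehension⁻ (onSide? i j)

  side-isSide : ∀ i j → IsSide G 𝒟 i j (side i j)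
  side-isSide i j v = mk⇔ (∈side⁻ {i} {j}) (∈side⁺ {i} {j})

  isSide⇒≡ : ∀ {i j A} → IsSide G 𝒟 i j A → A ≡ side i j
  isSide⇒≡ {i} {j} isSide = ⊆-antisym
    (λ {v} v∈ → ∈side⁺ {i} {j} (Equivalence.to (isSide v) v∈))
    (λ {v} v∈ → Equivalence.from (isSide v) (∈side⁻ {i} {j} v∈))

  side-mono : ∀ {i j k l} → (∀ {t} → Reachable i j t → Reachable k l t) → side i j ⊆ side k l
  side-mono {i} {j} {k} {l} h v∈ = let t , rs , v∈t = onSide⁻ (∈side⁻ {i} {j} v∈) in
    ∈side⁺ {k} {l} (onSide⁺ (h rs) v∈t)

  edgeSep : Fin m → Fin m → Sep n
  edgeSep i j = side i j , side j i

  induced⁺ : ∀ {i j} → Tᴬ i j → Induced G 𝒟 (edgeSep i j)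
  induced⁺ {i} {j} e = i , j , e , side-isSide i j , side-isSide j i

  induced⁻ : ∀ {s} → Induced G 𝒟 s → ∃₂ λ i j → Tᴬ i j × s ≡ edgeSep i j
  induced⁻ (i , j , e , sA , sB) = i , j , e , cong₂ _,_ (isSide⇒≡ {i} {j} sA) (isSide⇒≡ {j} {i} sB)

  induced? : Decidable (Induced G 𝒟)
  induced? s = map′ (λ { (i , j , e , refl) → induced⁺ e }) induced⁻
    (Fin.any? λ i → Fin.any? λ j → Graph.adj? tree i j ×-dec s ≟ˢ edgeSep i j)

  induced-swap : ∀ {s} → Induced G 𝒟 s → Induced G 𝒟 (swap s)
  induced-swap (i , j , e , sA , sB) = j , i , Graph.sym tree e , sB , sA

  -- For distinct edges, the middle component of the tree without both of them contains one end of
  -- each. `sides` treats the case that these ends are `i` and `k`; renaming ends gives the other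
  -- three.
  edgeSep-nested : ∀ {i j k l} → Tᴬ i j → Tᴬ k l → Nested (edgeSep i j) (edgeSep k l)
  edgeSep-nested {i} {j} {k} {l} e f with i Fin.≟ k ×-dec j Fin.≟ l | i Fin.≟ l ×-dec j Fin.≟ k
  ... | yes (refl , refl) | _ = inj₁ (inj₁ (≤ˢ-refl (edgeSep i j)))
  ... | _ | yes (refl , refl) = inj₂ (inj₁ (≤ˢ-refl (edgeSep i j)))
  ... | no ≢kl | no ≢lk = go (reachable-either e k) (reachable-either f i)
    where
    i~j : Without k l i j
    i~j = e , ≢kl , ≢lk
    k~l : Without i j k l
    k~l = f , (λ { (refl , refl) → ≢kl (refl , refl) }) , (λ { (refl , refl) → ≢lk (refl , refl) })

    sides : ∀ {i j k l} → Tᴬ i j → Tᴬ k l → ¬ (i ≡ k × j ≡ l) → ¬ (i ≡ l × j ≡ k) → Reachable i j k →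
        Reachable k l i →
      side j i ⊆ side k l × side l k ⊆ side i j
    sides {i} {j} {k} {l} e f ≢kl ≢lk i⇝k k⇝i = side-mono {j} {i} {k} {l} (reachable-⊆ e ≢kl ≢lk i⇝k k⇝i) ,
      side-mono {l} {k} {i} {j} (reachable-⊆ f (λ { (refl , refl) → ≢kl (refl , refl) })
          (λ { (refl , refl) → ≢lk (refl , refl) }) k⇝i i⇝k)

    e′ = Graph.sym tree e
    f′ = Graph.sym tree f

    go : Reachable i j k ⊎ Reachable j i k → Reachable k l i ⊎ Reachable l k i →
        Nested (edgeSep i j) (edgeSep k l)
    go (inj₁ i⇝k) (inj₁ k⇝i) = let a , b = sides e f ≢kl ≢lk i⇝k k⇝i in inj₂ (inj₂ (b , a))
    go (inj₂ j⇝k) (inj₁ k⇝i) =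
      let a , b = sides e′ f (λ (p , q) → ≢lk (q , p)) (λ (p , q) → ≢kl (q , p)) j⇝k (k⇝i ◅◅ (i~j ◅ ε)) in inj₁
              (inj₁ (a , b))
    go (inj₁ i⇝k) (inj₂ l⇝i) =
      let a , b = sides e f′ ≢lk ≢kl (i⇝k ◅◅ (k~l ◅ ε)) l⇝i in inj₁ (inj₂ (b , a))
    go (inj₂ j⇝k) (inj₂ l⇝i) =
      let a , b = sides e′ f′ (λ (p , q) → ≢kl (q , p)) (λ (p , q) → ≢lk (q , p))
                    (j⇝k ◅◅ (without-swap k~l ◅ ε)) (l⇝i ◅◅ (without-swap i~j ◅ ε)) in inj₂ (inj₁ (a , b))

  induced-nested : ∀ {s r} → Induced G 𝒟 s → Induced G 𝒟 r → Nested s r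
  induced-nested Is Ir with induced⁻ Is | induced⁻ Ir
  ... | _ , _ , e , refl | _ , _ , f , refl = edgeSep-nested e f

  -- The first edge of the path from `s` to `t` serves, since the path does not revisit `s`.
  parts-separated : ∀ {s t} → s ≢ t → ∃[ r ] Induced G 𝒟 r × part s ⊆ proj₁ r × part t ⊆ proj₂ r
  parts-separated {s} {t} s≢t = go (isPath⇒path (proj₂ (proj₁ (proj₂ isTree) s t)))
    where
    go : ∀ {p} → Path Tᴬ s p t → ∃[ r ] Induced G 𝒟 r × part s ⊆ proj₁ r × part t ⊆ proj₂ r
    go [ _ ] = ⊥-elim (s≢t refl)
    go (cons {y = u} e s∉ path) = edgeSep s u , induced⁺ e ,
      (λ v∈ → ∈side⁺ {s} {u} (onSide⁺ ε v∈)) ,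
      (λ v∈ → ∈side⁺ {u} {s} (onSide⁺ (gmap id without-swap (avoiding s∉ path)) v∈))

  induced-imageˢ : ∀ α (φ : Permutation′ m) → IsAutomorphism tree φ →
      (∀ t → image α (part t) ≡ part (φ ⟨$⟩ʳ t)) →
    ∀ {s} → Induced G 𝒟 s → Induced G 𝒟 (imageˢ α s)
  induced-imageˢ α φ auto moves (i , j , e , sA , sB) =
    φ ⟨$⟩ʳ i , φ ⟨$⟩ʳ j , Equivalence.to (auto i j) e , image-isSide sA , image-isSide sB
    where
    to : ∀ {i j u v} → Without i j u v → Without (φ ⟨$⟩ʳ i) (φ ⟨$⟩ʳ j) (φ ⟨$⟩ʳ u) (φ ⟨$⟩ʳ v)
    to (e , a , b) = Equivalence.to (auto _ _) e , (λ (p , q) → a (inj p , inj q)) ,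
        (λ (p , q) → b (inj p , inj q))
      where
      inj : ∀ {x y} → φ ⟨$⟩ʳ x ≡ φ ⟨$⟩ʳ y → x ≡ y
      inj p = trans (sym (inverseˡ φ)) (trans (cong (φ ⟨$⟩ˡ_) p) (inverseˡ φ))
    from : ∀ {i j u v} → Without (φ ⟨$⟩ʳ i) (φ ⟨$⟩ʳ j) u v → Without i j (φ ⟨$⟩ˡ u) (φ ⟨$⟩ˡ v)
    from (e , a , b) = Equivalence.to (flip-isAutomorphism tree φ auto _ _) e ,
        (λ (p , q) → a (back p , back q)) , (λ (p , q) → b (back p , back q))
      where
      back : ∀ {x y} → φ ⟨$⟩ˡ x ≡ y → x ≡ φ ⟨$⟩ʳ y
      back p = trans (sym (inverseʳ φ)) (cong (φ ⟨$⟩ʳ_) p)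
    image-isSide : ∀ {i j A} → IsSide G 𝒟 i j A → IsSide G 𝒟 (φ ⟨$⟩ʳ i) (φ ⟨$⟩ʳ j) (image α A)
    image-isSide {i} {j} {A} isSide v = mk⇔
      (λ v∈ → let t , rs , u∈ = onSide⁻ (Equivalence.to (isSide _) (∈image⁻ α v∈)) in
        onSide⁺ (gmap (φ ⟨$⟩ʳ_) to rs) (subst (v ∈_) (moves t) (∈image⁺ α u∈)))
      (λ on → let t , rs , v∈ = onSide⁻ on in
        ∈image⁺ α (Equivalence.from (isSide _) (onSide⁺
            (subst (λ x → Star (Without i j) x (φ ⟨$⟩ˡ t)) (inverseˡ φ) (gmap (φ ⟨$⟩ˡ_) from rs))
          (∈image⁻ α (subst (v ∈_) (trans (cong part (sym (inverseʳ φ))) (sym (moves (φ ⟨$⟩ˡ t)))) v∈)))))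

-- Refining a distinguishing nested set of separations

module Refinement (k : ℕ) {n} (G : Graph n) (S : Pred (Sep n) 0ℓ) (S? : Decidable S)
  (S-swap : ClosedUnderInverses S)
  (S-valid : ∀ s → S s → IsSeparation G s × Proper s × order s < k)
  (S-tight : ∀ s → IsSeparation G s → Tight G s → Proper s → order s < k → S s)
  where

  S-separation : ∀ {s} → S s → IsSeparation G s
  S-separation Ss = proj₁ (S-valid _ Ss)

  S-order : ∀ {s} → S s → order s < k
  S-order Ss = proj₂ (proj₂ (S-valid _ Ss))

  NestedWithAll : Pred (Sep n) 0ℓ
  NestedWithAll s = ∀ r → S r → Nested s r

  nestedWithAll? : Decidable NestedWithAll
  nestedWithAll? s = all? finite-Sep λ r → S? r →-dec nested? s r

  actsOn-flip : ∀ α → ActsOn α S → ActsOn (flip α) S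
  actsOn-flip α acts s = mk⇔
    (λ Ss → Equivalence.from (acts _) (subst S (sym (imageˢ-flip α s)) Ss))
    (λ Ss′ → subst S (imageˢ-flip α s) (Equivalence.to (acts _) Ss′))

  nestedWithAll-imageˢ : ∀ α → ActsOn α S → ∀ {s} → NestedWithAll s → NestedWithAll (imageˢ α s)
  nestedWithAll-imageˢ α acts {s} h r Sr = subst (Nested (imageˢ α s)) (imageˢ-flip α r)
    (imageˢ-nested α (h (imageˢ (flip α) r) (Equivalence.to (actsOn-flip α acts r) Sr)))

  PointsTo : Subset n → Pred (Sep n) 0ℓ
  PointsTo X s = Profile G k X s × S s

  pointsTo? : ∀ X → Decidable (PointsTo X)
  pointsTo? X s = (isSeparation? G s ×-dec (order s ℕ.<? k ×-dec X ⊆? proj₂ s)) ×-dec S? s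

  pointsTo⁺ : ∀ {X s} → S s → X ⊆ proj₂ s → PointsTo X s
  pointsTo⁺ Ss X⊆ = (S-separation Ss , S-order Ss , X⊆) , Ss

  -- Orient `r` towards `X` and pass to a maximal `r′` above it, which is nested with `s` by
  -- assumption. Every way of being nested passes down to `r`, except `swap r′ ≤ˢ s`, which would
  -- put `X` on both sides of `r′`.
  wellSeparated-maximal : ∀ {X s} → IsBlock G k X → WellSeparated G k S X → Maximal _≤ˢ_ (PointsTo X) s →
      NestedWithAll s
  wellSeparated-maximal {X} {s} bX ws max@(((_ , _ , X⊆B) , _) , _) r Sr =
    case block-unsplit G bX (S-separation Sr) (S-order Sr) of λ where
      (inj₁ X⊆C) → nested-swapʳ {s = s} {swap r} (go (swap r) (S-swap r Sr) X⊆C)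
      (inj₂ X⊆D) → go r Sr X⊆D
    where
    go : ∀ r → S r → X ⊆ proj₂ r → Nested s r
    go r Sr X⊆D = let r′ , (P′ , Sr′) , r≤r′ , r′-max = maximal-above (pointsTo? X) {r} (pointsTo⁺ Sr X⊆D) in
      below r′ Sr′ (proj₂ (proj₂ P′)) r≤r′ (ws s r′ max ((P′ , Sr′) , r′-max))
      where
      below : ∀ r′ → S r′ → X ⊆ proj₂ r′ → r ≤ˢ r′ → Nested s r′ → Nested s r
      below r′ Sr′ X⊆D′ r≤r′ (inj₁ (inj₁ s≤r′)) =
        inj₁ (inj₂ (subst (r ≤ˢ_) (proj₂ max r′ (pointsTo⁺ Sr′ X⊆D′) s≤r′) r≤r′))
      below r′ Sr′ X⊆D′ r≤r′ (inj₁ (inj₂ r′≤s)) = inj₁ (inj₂ (≤ˢ-trans {s = r} {r′} {s} r≤r′ r′≤s))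
      below r′ Sr′ X⊆D′ r≤r′ (inj₂ (inj₁ s≤r′*)) = inj₂
          (inj₁ (≤ˢ-trans {s = s} {swap r′} {swap r} s≤r′* (swap-≤ˢ {s = r} {r′} r≤r′)))
      below r′ Sr′ X⊆D′ r≤r′ (inj₂ (inj₂ (_ , B⊆C′))) = ⊥-elim
        (block-one-side G bX {r′} (S-order Sr′) (λ x∈ → B⊆C′ (X⊆B x∈)) X⊆D′)

  -- Maximal separations of a reduced and feasible task

  MaximalInS : Pred (Sep n) 0ℓ
  MaximalInS s = S s × (∀ r → S r → s ≤ˢ r → r ≡ s)

  module _ (reduced : Reduced S (BlockProfile G k)) (feasible : Feasible S (BlockProfile G k)) where

    block-in : ∀ {s} → S s → ∃[ X ] IsBlock G k X × X ⊆ proj₂ s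
    block-in Ss = let P , _ , (X , bX , P⊆ , _) , _ , Ps , _ = reduced _ Ss in X , bX , proj₂ (proj₂ (P⊆ Ps))

    -- Feasibility yields an element of `S` above both `s` and `r`. By maximality it is `s`, so `r`
    -- lies below `s`.
    opposite-corners : ∀ {s r X Y} → MaximalInS s → S r → IsBlock G k X → IsBlock G k Y →
      X ⊆ proj₂ s → X ⊆ proj₂ r → Y ⊆ proj₁ s → Y ⊆ proj₁ r → ¬ Cross s r
    opposite-corners {s} {r} {X} {Y} (Ss , max) Sr bX bY X⊆B X⊆D Y⊆A Y⊆C cross =
      let e , _ , Se , s∨r≤e = feasible s r Ss Sr cross (Profile G k X) (Profile G k Y)
            (X , bX , id , id) (Y , bY , id , id)
            (proj₁ (pointsTo⁺ Ss X⊆B)) (proj₁ (pointsTo⁺ Sr X⊆D))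
            (proj₁ (pointsTo⁺ (S-swap s Ss) Y⊆A)) (proj₁ (pointsTo⁺ (S-swap r Sr) Y⊆C))
          e≡s = max e Se (≤ˢ-trans {s = s} {s ∨ˢ r} {e} (≤ˢ-∨ˢˡ s r) s∨r≤e)
      in cross (inj₁ (inj₂ (subst (r ≤ˢ_) e≡s (≤ˢ-trans {s = r} {s ∨ˢ r} {e} (≤ˢ-∨ˢʳ s r) s∨r≤e))))

    -- Reducedness gives a block on each side of `s`. If `r` separates the two, they lie in opposite
    -- corners. If not, a block on the other side of `r`, which exists by reducedness as well, lies
    -- opposite to one of them.
    maximalInS-nested : ∀ {s} → MaximalInS s → NestedWithAll s
    maximalInS-nested {s} max@(Ss , _) r Sr = decidable-stable (nested? s r) contra
      where
      module _ {X X′} (bX : IsBlock G k X) (bX′ : IsBlock G k X′) (X⊆B : X ⊆ proj₂ s)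
          (X′⊆A : X′ ⊆ proj₁ s) where

        towards : ∀ r → S r → Cross s r → X ⊆ proj₂ r → X′ ⊆ proj₁ r ⊎ X′ ⊆ proj₂ r → Empty.⊥
        towards r Sr cross X⊆D (inj₁ X′⊆C) = opposite-corners {s} {r} max Sr bX bX′ X⊆B X⊆D X′⊆A X′⊆C cross
        towards r Sr cross X⊆D (inj₂ X′⊆D) = let Y , bY , Y⊆C = block-in (S-swap r Sr) in
          case block-unsplit G bY (S-separation Ss) (S-order Ss) of λ where
            (inj₁ Y⊆A) → opposite-corners {s} {r} max Sr bX bY X⊆B X⊆D Y⊆A Y⊆C cross
            (inj₂ Y⊆B) → opposite-corners {s} {swap r} max (S-swap r Sr) bY bX′ Y⊆B Y⊆C X′⊆A X′⊆D
              λ h → cross (nested-swapʳ {s = s} {swap r} h)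

        both-sides : Cross s r → Empty.⊥
        both-sides cross =
          case block-unsplit G bX (S-separation Sr) (S-order Sr) of λ where
            (inj₁ X⊆C) → towards (swap r) (S-swap r Sr) (λ h → cross (nested-swapʳ {s = s} {swap r} h)) X⊆C
                (Sum.swap X′-side)
            (inj₂ X⊆D) → towards r Sr cross X⊆D X′-side
          where X′-side = block-unsplit G bX′ (S-separation Sr) (S-order Sr)

      contra : ¬ Cross s r
      contra cross = let X , bX , X⊆B = block-in Ss ; X′ , bX′ , X′⊆A = block-in (S-swap s Ss) in
        both-sides bX bX′ (λ {x} → X⊆B {x}) (λ {x} → X′⊆A {x}) cross

    -- `s` is the only maximal element of the profile in `S`: a maximal `q` is nested with `s`, and
    -- every way of being nested makes them equal or puts `X` on both sides of one separation.
    maximalInS-wellSeparated : ∀ {s X} → MaximalInS s → IsBlock G k X → X ⊆ proj₂ s → WellSeparated G k S X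
    maximalInS-wellSeparated {s} {X} max@(Ss , s-max) bX X⊆B q r hq hr =
      subst (Nested q) (trans (only q hq) (sym (only r hr))) (inj₁ (inj₁ (≤ˢ-refl q)))
      where
      only : ∀ q → Maximal _≤ˢ_ (PointsTo X) q → q ≡ s
      only q (((_ , o , X⊆D) , Sq) , q-max) = go (maximalInS-nested max q Sq)
        where
        go : Nested s q → q ≡ s
        go (inj₁ (inj₁ s≤q)) = s-max q Sq s≤q
        go (inj₁ (inj₂ q≤s)) = sym (q-max s (pointsTo⁺ Ss X⊆B) q≤s)
        go (inj₂ (inj₁ s≤q*)) = ⊥-elim (block-one-side G bX {s} (S-order Ss)
          (subst (λ t → X ⊆ proj₁ t) (s-max (swap q) (S-swap q Sq) s≤q*) X⊆D) X⊆B)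
        go (inj₂ (inj₂ (_ , B⊆C))) = ⊥-elim (block-one-side G bX {q} o (λ x∈ → B⊆C (X⊆B x∈)) X⊆D)

  module _ (N₀ : Pred (Sep n) 0ℓ) (N₀? : Decidable N₀)
    (N₀-swap : ∀ {s} → N₀ s → N₀ (swap s)) (N₀⊆S : ∀ {s} → N₀ s → S s)
    (N₀-nested : ∀ {s r} → N₀ s → N₀ r → Nested s r)
    (N₀-imageˢ : ∀ α → IsAutomorphism G α → ActsOn α S → ∀ {s} → N₀ s → N₀ (imageˢ α s))
    (N₀-distinguishes : ∀ {X Y} → IsBlock G k X → IsBlock G k Y → X ≢ Y →
        ∃[ s ] N₀ s × X ⊆ proj₁ s × Y ⊆ proj₂ s)
    where

    N : Pred (Sep n) 0ℓ
    N s = S s × (N₀ s ⊎ NestedWithAll s)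

    N? : Decidable N
    N? s = S? s ×-dec (N₀? s ⊎-dec nestedWithAll? s)

    N-swap : ∀ {s} → N s → N (swap s)
    N-swap {s} (Ss , h) = S-swap s Ss , Sum.map N₀-swap (λ all r Sr → nested-swapˡ {s = s} {r} (all r Sr)) h

    N-nested : ∀ {s r} → N s → N r → Nested s r
    N-nested (_ , inj₁ Ns) (_ , inj₁ Nr) = N₀-nested Ns Nr
    N-nested (_ , inj₂ all) (Sr , _)     = all _ Sr
    N-nested (Ss , _) (_ , inj₂ all)     = nested-sym (all _ Ss)

    N-imageˢ : ∀ α → IsAutomorphism G α → ActsOn α S → ∀ {s} → N s → N (imageˢ α s)
    N-imageˢ α auto acts {s} (Ss , h) = Equivalence.to (acts s) Ss ,
        Sum.map (N₀-imageˢ α auto acts) (nestedWithAll-imageˢ α acts {s}) h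

    open NestedTree G N N? N-swap (λ Ns → S-separation (proj₁ Ns))
        (λ Ns → proj₁ (proj₂ (S-valid _ (proj₁ Ns)))) N-nested

    blocksInDifferentParts : BlocksInDifferentParts G decomposition k
    blocksInDifferentParts =
      (λ X bX → let t , _ , _ , X⊆t , _ = walk-to-part (λ Ns → block-unsplit G bX (S-separation (proj₁ Ns)) (S-order (proj₁ Ns))) root in t , X⊆t) ,
      λ X Y bX bY X≢Y s t X⊆s Y⊆t s≡t →
        let r , N₀r , X⊆A , Y⊆B = N₀-distinguishes bX bY X≢Y
            o = S-order (N₀⊆S N₀r)
        in case part-one-side {r} s (N₀⊆S N₀r , inj₁ N₀r) of λ where
             (inj₁ s⊆A) → block-one-side G bY {r} o (λ {y} y∈ → s⊆A (subst (y ∈_) (sym s≡t) (Y⊆t y∈))) Y⊆B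
             (inj₂ s⊆B) → block-one-side G bX {r} o X⊆A (λ x∈ → s⊆B (X⊆s x∈))

    wellSeparatedBlocksAreParts : WellSeparatedBlocksAreParts G decomposition k S
    wellSeparatedBlocksAreParts X bX ws t X⊆t = ⊆-antisym
        (λ {v} v∈t → decidable-stable (v ∈? X) (not-outside v∈t)) X⊆t
      where
      not-outside : ∀ {v} → v ∈ part t → ¬ v ∉ X
      not-outside v∈t v∉X =
        let s₀ , (sep , tight , proper , o) , X⊆B₀ , v∉B₀ = separate-vertex G bX v∉X
            s , Q@((_ , o′ , X⊆B) , Ss) , s₀≤s , s-max = maximal-above (pointsTo? X) {s₀}
                (pointsTo⁺ (S-tight s₀ sep tight proper o) X⊆B₀)
        in case part-one-side {s} t (Ss , inj₂ (wellSeparated-maximal bX ws (Q , s-max))) of λ where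
             (inj₁ t⊆A) → block-one-side G bX {s} o′ (λ x∈ → t⊆A (X⊆t x∈)) X⊆B
             -- Passing from `s₀` up to `s` shrinks the right side, so `v` remains outside.
             (inj₂ t⊆B) → v∉B₀ (proj₂ s₀≤s (t⊆B v∈t))

    leafPartsAreBlocks : Reduced S (BlockProfile G k) → Feasible S (BlockProfile G k) →
        LeafPartsAreBlocks G decomposition k
    leafPartsAreBlocks reduced feasible t leaf =
      let s , (Ss , _) , N-max , B⊆t = leaf-separation leaf
          s′ , Ss′ , s≤s′ , s′-max = maximal-above S? Ss
          -- `s` was maximal in `N` only. Being nested with all of `S`, the larger `s′` belongs to
          -- `N`, so `s` is maximal in `S`.
          s′≡s = N-max s′ (Ss′ , inj₂ (maximalInS-nested reduced feasible (Ss′ , s′-max))) s≤s′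
          max = subst MaximalInS s′≡s (Ss′ , s′-max)
          X , bX , X⊆B = block-in reduced feasible Ss
      in subst (IsBlock G k)
            (sym (wellSeparatedBlocksAreParts X bX (maximalInS-wellSeparated reduced feasible max bX X⊆B) t
            (λ x∈ → B⊆t (X⊆B x∈)))) bX

    refinement : ∃[ 𝒟 ] (∀ s → N₀ s → Induced G 𝒟 s) × Canonical G 𝒟 S × InducedIn G 𝒟 S ×
        BlocksInDifferentParts G 𝒟 k ×
      WellSeparatedBlocksAreParts G 𝒟 k S × (Reduced S (BlockProfile G k) → Feasible S (BlockProfile G k) →
          LeafPartsAreBlocks G 𝒟 k)
    refinement = decomposition , (λ s N₀s → N⇒induced (N₀⊆S N₀s , inj₁ N₀s)) , canonical N-imageˢ actsOn-flip ,
      (λ s Is → proj₁ (induced⇒N Is)) , blocksInDifferentParts , wellSeparatedBlocksAreParts ,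
          leafPartsAreBlocks

theorem3p1 : ∀ (k : ℕ) → 1 ≤ k →
    ∀ {n : ℕ} (G : Graph n) (S : Pred (Sep n) 0ℓ) → Decidable S →
    ClosedUnderInverses S →
    (∀ s → S s → IsSeparation G s × Proper s × order s < k) →
    (∀ s → IsSeparation G s → Tight G s → Proper s → order s < k → S s) →
    (∃[ 𝒟 ]
    Canonical G 𝒟 S × InducedIn G 𝒟 S ×
    BlocksInDifferentParts G 𝒟 k ×
    WellSeparatedBlocksAreParts G 𝒟 k S ×
    (Reduced S (BlockProfile G k) → Feasible S (BlockProfile G k) →
    LeafPartsAreBlocks G 𝒟 k)) ×
    (∀ 𝒟 → Canonical G 𝒟 S → InducedIn G 𝒟 S → BlocksInDifferentParts G 𝒟 k →
    ∃[ 𝒟′ ]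
    Refines G 𝒟′ 𝒟 ×
    Canonical G 𝒟′ S × InducedIn G 𝒟′ S ×
    BlocksInDifferentParts G 𝒟′ k ×
    WellSeparatedBlocksAreParts G 𝒟′ k S ×
    (Reduced S (BlockProfile G k) → Feasible S (BlockProfile G k) →
    LeafPartsAreBlocks G 𝒟′ k))
theorem3p1 k _ {n} G S S? S-swap S-valid S-tight = existence , refine
  where
  open Refinement k G S S? S-swap S-valid S-tight

  existence = let 𝒟 , _ , properties = refinement (OptimalDistinguisher G k) (optimalDistinguisher? G k)
                    (λ (X , Y , bX , bY , X≢Y , opt) → Y , X , bY , bX , (λ e → X≢Y (sym e)) ,
                        optimal-swap G opt)
                    (λ {s} (X , Y , bX , bY , X≢Y , opt) → S-tight s (proj₁ (proj₁ opt))
                        (optimal-tight G bX bY X≢Y opt)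
                       (optimal-proper G bX bY X≢Y opt) (optimal-order G bX bY X≢Y opt))
                    (optimalDistinguisher-nested G k)
                    (λ α auto _ → optimalDistinguisher-imageˢ G α auto k)
                    (λ bX bY X≢Y → let s , opt = optimal-exists G bX bY X≢Y in
                       s , (_ , _ , bX , bY , X≢Y , opt) , proj₂ (proj₁ opt))
              in 𝒟 , properties

  refine : ∀ 𝒟 → Canonical G 𝒟 S → InducedIn G 𝒟 S → BlocksInDifferentParts G 𝒟 k → _
  refine 𝒟 canonical inS (inParts , different) =
      refinement (Induced G 𝒟) induced? induced-swap (λ {s} → inS s) induced-nested
    (λ α auto acts → let φ , φ-auto , moves = canonical α auto acts in induced-imageˢ α φ φ-auto moves)
    λ {X} {Y} bX bY X≢Y →
      let s , X⊆s = inParts X bX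
          t , Y⊆t = inParts Y bY
          r , Ir , s⊆A , t⊆B = parts-separated {s} {t} λ s≡t →
              different X Y bX bY X≢Y s t X⊆s Y⊆t (cong (TreeDecomposition.part 𝒟) s≡t)
      in r , Ir , (λ x∈ → s⊆A (X⊆s x∈)) , (λ y∈ → t⊆B (Y⊆t y∈))
    where open InducedSeparations G 𝒟
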